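{- Let $c_0,c_1,c_2$ be non-zero integers and let $n=3$ and $m_0=m_1=m_2=m_3=2$. Then $$N(\mathbb{P}^{2},\Delta;B)\gg B\log B$$ for all sufficiently large $B$, where the implied constant depends only on $c_0,c_1,c_2$.
   Context: A non-zero integer $x$ is called $2$-full (squareful) if $p^2\mid x$ for every prime $p$ dividing $x$. For $\mathbf{x}=(x_0,\dots,x_3)$ write $|\mathbf{x}|=\max_i|x_i|$. The counting function is $$N(\mathbb{P}^{2},\Delta;B)=\frac{1}{2}\#\left\{\mathbf{x}\in(\mathbb{Z}\setminus\{0\})^{4}: \gcd(x_0,x_1,x_2)=1,\ |\mathbf{x}|\leq B,\ x_i \text{ is } 2\text{ -full for all } 0\leq i\leq 3,\ c_0x_0+c_1x_1+c_2x_2=x_3\right\}.$$ -}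

module Defs where

open import Data.Nat as ℕ using (ℕ; zero; suc; NonZero; _≤_; _<_)
open import Data.Nat.Properties as ℕP using (≤-<-trans; n<1+n)
open import Data.Nat.Divisibility using (_∣_; _∣?_; ∣⇒≤; _∣0)
open import Data.Nat.Primality using (Prime; prime?)
open import Data.Nat.GCD using (gcd)
open import Data.Integer as ℤ using (ℤ; +_; -[1+_]; ∣_∣)
open import Data.Fin using (Fin; toℕ; fromℕ<)
open import Data.Fin.Properties using (all?; toℕ-fromℕ<)
open import Data.List using (List; []; _∷_; map; concatMap; filter; length; upTo; _++_)
open import Data.Product using (_×_; _,_)
open import Relation.Nullary using (Dec; yes; no; ¬_)
open import Relation.Nullary.Decidable using (map′; _×-dec_; _→-dec_)
open import Relation.Binary.PropositionalEquality using (_≡_; refl; subst)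

Squarefulℕ : ℕ → Set
Squarefulℕ n = ∀ p → Prime p → p ∣ n → p ℕ.^ 2 ∣ n

Squareful : ℤ → Set
Squareful x = Squarefulℕ ∣ x ∣

-- decidability of 2-fullness (only primes p ≤ n need checking when n ≠ 0)
private
  bounded : ℕ → Set
  bounded n = ∀ (i : Fin (suc n)) → Prime (toℕ i) → toℕ i ∣ n → toℕ i ℕ.^ 2 ∣ n

  bounded? : ∀ n → Dec (bounded n)
  bounded? n = all? (λ i → prime? (toℕ i) →-dec ((toℕ i ∣? n) →-dec (toℕ i ℕ.^ 2 ∣? n)))

squarefulℕ? : ∀ n → Dec (Squarefulℕ n)
squarefulℕ? zero = yes (λ p _ _ → (p ℕ.^ 2) ∣0)
squarefulℕ? (suc n) = map′ to from (bounded? (suc n))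
  where
  to : bounded (suc n) → Squarefulℕ (suc n)
  to h p pp p∣n = subst (λ q → q ℕ.^ 2 ∣ suc n) (toℕ-fromℕ< lt)
                    (h (fromℕ< lt) (subst Prime (Relation.Binary.PropositionalEquality.sym (toℕ-fromℕ< lt)) pp)
                       (subst (_∣ suc n) (Relation.Binary.PropositionalEquality.sym (toℕ-fromℕ< lt)) p∣n))
    where lt = ℕ.s≤s (∣⇒≤ p∣n)
  from : Squarefulℕ (suc n) → bounded (suc n)
  from h i = h (toℕ i)

squareful? : ∀ x → Dec (Squareful x)
squareful? x = squarefulℕ? ∣ x ∣

nonzeroUpTo : ℕ → List ℤ
nonzeroUpTo B = map (λ k → + suc k) (upTo B) ++ map (λ k → -[1+ k ]) (upTo B)

Tuple : Set
Tuple = ℤ × ℤ × ℤ × ℤ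

box : ℕ → List Tuple
box B = concatMap (λ a → concatMap (λ b → concatMap (λ c → map (λ d → (a , b , c , d)) R) R) R) R
  where R = nonzeroUpTo B

Cond : ℤ → ℤ → ℤ → Tuple → Set
Cond c₀ c₁ c₂ (x₀ , x₁ , x₂ , x₃) =
  (gcd (gcd ∣ x₀ ∣ ∣ x₁ ∣) ∣ x₂ ∣ ≡ 1) ×
  Squareful x₀ × Squareful x₁ × Squareful x₂ × Squareful x₃ ×
  (c₀ ℤ.* x₀ ℤ.+ c₁ ℤ.* x₁ ℤ.+ c₂ ℤ.* x₂ ≡ x₃)

cond? : ∀ c₀ c₁ c₂ t → Dec (Cond c₀ c₁ c₂ t)
cond? c₀ c₁ c₂ (x₀ , x₁ , x₂ , x₃) =
  (gcd (gcd ∣ x₀ ∣ ∣ x₁ ∣) ∣ x₂ ∣ ℕ.≟ 1) ×-dec squareful? x₀ ×-dec squareful? x₁ ×-dec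
  squareful? x₂ ×-dec squareful? x₃ ×-dec (c₀ ℤ.* x₀ ℤ.+ c₁ ℤ.* x₁ ℤ.+ c₂ ℤ.* x₂ ℤ.≟ x₃)

N : ℤ → ℤ → ℤ → ℕ → ℕ
N c₀ c₁ c₂ B = length (filter (cond? c₀ c₁ c₂) (box B)) ℕ./ 2

{-# OPTIONS --safe #-}
module Submission where

-- A base solution (a₀, a₁, a₂, a₃) with c₀a₀ = u X², a₃ = u U², c₂a₂ = θ, c₁a₁ = −θ y² turns the substitution
-- xᵢ = aᵢ zᵢ² into the quadric u ((U z₃)² − (X z₀)²) = θ (z₂² − (y z₁)²), whose discriminant is a square.  It is a
-- copy of ℙ¹ × ℙ¹: with α = U + X, β = U − X, γ = 1 + y, δ = 1 − y its points are given by
--   U z₃ − X z₀ = β r s,   U z₃ + X z₀ = α t v,   z₂ − y z₁ = δ r v,   z₂ + y z₁ = γ s t,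
-- for coprime pairs (r, t), (s, v).  Taking r, s, t, v ≡ 1 modulo a multiple L of everything in sight makes the zᵢ
-- integral, keeps gcd(x₀, x₁, x₂) = 1 and makes the parametrisation injective.  For a ≍ 2^l, b ≍ 2^(E − l), a
-- positive proportion of the pairs (r, t) of size a and of the pairs (s, v) of size b are coprime, which gives
-- ≫ 4^E solutions of height ≪ 4^E for each of the levels l = 0, …, E; the levels supply the factor log B.
--
-- The base solution has to satisfy the coprimality and squarefulness conditions at all primes at once.  Up to sign
-- write c₀ = p q m, c₂ = q C f with m, C squareful, p q squarefree, C supported on p q, and m, f coprime to p q.
-- Choose B ≡ 0 mod m f (1 − y²), B ≡ 1 mod p⁴, B ≡ −1 mod q², and let U, X be proportional to 1 + B³, 1 − B³.
-- Then u = m q C works: X is divisible by p², U by q, and U² − X² is a squareful multiple of f (1 − y²).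

open import Defs
open import Data.Nat using (ℕ; _≤_)
open import Data.Nat.Logarithm using (⌊log₂_⌋)
open import Data.Integer using (ℤ)
open import Data.Product using (Σ; _×_)
open import Relation.Binary.PropositionalEquality using (_≢_)

open import Data.Empty using (⊥; ⊥-elim)
open import Data.List using (List; []; _∷_; _++_; map; filter; length; concat; concatMap; upTo; cartesianProduct)
open import Data.List.Membership.Propositional using (_∈_; lose)
open import Data.List.Membership.Propositional.Properties
open import Data.List.Relation.Unary.All as All using (All; []; _∷_)
open import Data.Nat.Coprimality as Coprimality using (Coprime; coprime?)
open import Data.Nat.GCD using (gcd; gcd[m,n]∣m; gcd[m,n]∣n; gcd-greatest; c*gcd[m,n]≡gcd[cm,cn]; module Bézout)
open import Data.Product using (∃; _,_; proj₁; proj₂)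
open import Data.Sum using (_⊎_; inj₁; inj₂; [_,_]′)
open import Relation.Binary.PropositionalEquality using (_≡_; refl; sym; trans; cong; cong₂; subst; subst₂; module ≡-Reasoning)
open import Relation.Nullary using (yes; no; ¬_; contradiction)
open import Relation.Nullary.Decidable using (_×-dec_; _⊎-dec_; ¬?; decidable-stable)

-- Counting coprime pairs in an arithmetic progression.

module Counting where

  open import Data.Nat using (zero; suc; _<_; _+_; _*_; _∸_; _^_; z≤n; s≤s; >-nonZero)
  open import Data.Nat.Properties
  open import Data.Nat.Divisibility
  open import Data.Nat.ListAction using (sum)
  open import Data.Nat.Tactic.RingSolver using (solve-∀)
  open import Data.List.Properties using (filter-++; length-++; filter-accept; filter-reject; filter-all; map-cong; length-map)
  open import Data.List.Relation.Binary.Disjoint.Propositional using (Disjoint)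
  import Data.List.Relation.Unary.AllPairs.Properties as AllPairs
  open import Data.List.Relation.Unary.AllPairs as AllPairs using ([]; _∷_)
  open import Data.List.Relation.Unary.Any using (here; there)
  open import Data.List.Relation.Unary.Unique.Propositional using (Unique)
  import Data.List.Relation.Unary.Unique.Propositional.Properties as Unique
  open import Relation.Unary using (Decidable)

  private variable
    A X Y : Set
    P Q R : A → Set

  count : {P : A → Set} → Decidable P → List A → ℕ
  count P? xs = length (filter P? xs)

  range : ℕ → ℕ → List ℕ
  range a zero    = []
  range a (suc n) = a ∷ range (suc a) n

  ∈-range⁻ : ∀ {i} a n → i ∈ range a n → a ≤ i × i < a + n
  ∈-range⁻ a (suc n) (here refl) = ≤-refl , m<m+n a (s≤s z≤n)
  ∈-range⁻ {i} a (suc n) (there i∈) with ∈-range⁻ (suc a) n i∈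
  ... | a<i , i< = <⇒≤ a<i , subst (i <_) (sym (+-suc a n)) i<

  ∈-range⁺ : ∀ {i} a n → a ≤ i → i < a + n → i ∈ range a n
  ∈-range⁺ {i} a zero a≤i i< = contradiction a≤i (<⇒≱ (subst (i <_) (+-identityʳ a) i<))
  ∈-range⁺ {i} a (suc n) a≤i i< with m≤n⇒m<n∨m≡n a≤i
  ... | inj₁ a<i  = there (∈-range⁺ (suc a) n a<i (subst (i <_) (+-suc a n) i<))
  ... | inj₂ refl = here refl

  range-unique : ∀ a n → Unique (range a n)
  range-unique a zero    = []
  range-unique a (suc n) =
    All.tabulate (λ i∈ a≡i → <⇒≢ (proj₁ (∈-range⁻ (suc a) n i∈)) a≡i) ∷ range-unique (suc a) n

  length-range : ∀ a n → length (range a n) ≡ n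
  length-range a zero    = refl
  length-range a (suc n) = cong suc (length-range (suc a) n)

  count-accept : (P? : Decidable P) {x : A} {xs : List A} → P x → count P? (x ∷ xs) ≡ suc (count P? xs)
  count-accept P? px = cong length (filter-accept P? px)

  count-reject : (P? : Decidable P) {x : A} {xs : List A} → ¬ P x → count P? (x ∷ xs) ≡ count P? xs
  count-reject P? ¬px = cong length (filter-reject P? ¬px)

  count-++ : (P? : Decidable P) (xs ys : List A) → count P? (xs ++ ys) ≡ count P? xs + count P? ys
  count-++ P? xs ys = trans (cong length (filter-++ P? xs ys)) (length-++ (filter P? xs))

  count-⊎ : (P? : Decidable P) (Q? : Decidable Q) (xs : List A) →
            count (λ x → P? x ⊎-dec Q? x) xs ≤ count P? xs + count Q? xs
  count-⊎ P? Q? [] = z≤n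
  count-⊎ P? Q? (x ∷ xs) with P? x | Q? x | count-⊎ P? Q? xs
  ... | yes _ | yes _ | ih = s≤s (≤-trans ih (+-monoʳ-≤ (count P? xs) (n≤1+n _)))
  ... | yes _ | no _  | ih = s≤s ih
  ... | no _  | yes _ | ih = ≤-trans (s≤s ih) (≤-reflexive (sym (+-suc (count P? xs) _)))
  ... | no _  | no _  | ih = ih

  union-bound : (P? : Decidable P) {Q : ℕ → A → Set} (Q? : ∀ d → Decidable (Q d)) (ds : List ℕ) (xs : List A) →
                (∀ {x} → x ∈ xs → P x ⊎ (∃ λ d → d ∈ ds × Q d x)) →
                length xs ≤ count P? xs + sum (map (λ d → count (Q? d) xs) ds)
  union-bound P? Q? [] xs cover = ≤-reflexive (trans (cong length (sym (filter-all P? (All.tabulate all)))) (sym (+-identityʳ _)))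
    where
    all : ∀ {x} → x ∈ xs → _
    all x∈ with cover x∈
    ... | inj₁ px = px
  union-bound {P = P} P? {Q} Q? (d ∷ ds) xs cover = begin
    length xs                                             ≤⟨ union-bound (λ x → P? x ⊎-dec Q? d x) Q? ds xs cover′ ⟩
    count (λ x → P? x ⊎-dec Q? d x) xs + rest             ≤⟨ +-monoˡ-≤ rest (count-⊎ P? (Q? d) xs) ⟩
    count P? xs + count (Q? d) xs + rest                  ≡⟨ +-assoc (count P? xs) _ rest ⟩
    count P? xs + (count (Q? d) xs + rest)                ∎
    where
    open ≤-Reasoning
    rest = sum (map (λ d → count (Q? d) xs) ds)
    cover′ : ∀ {x} → x ∈ xs → (P x ⊎ Q d x) ⊎ (∃ λ d → d ∈ ds × Q d x)
    cover′ x∈ with cover x∈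
    ... | inj₁ px                        = inj₁ (inj₁ px)
    ... | inj₂ (_ , here refl , q)       = inj₁ (inj₂ q)
    ... | inj₂ (d′ , there d′∈ , q)      = inj₂ (d′ , d′∈ , q)

  count-product : {P : X → Set} {Q : Y → Set} (P? : Decidable P) (Q? : Decidable Q) (xs : List X) (ys : List Y) →
                  count (λ (x , y) → P? x ×-dec Q? y) (cartesianProduct xs ys) ≡ count P? xs * count Q? ys
  count-product P? Q? [] ys = refl
  count-product {X} {Y} {P} {Q} P? Q? (x ∷ xs) ys = trans (count-++ PQ? (map (x ,_) ys) _) (by-cases (P? x))
    where
    PQ? : Decidable (λ ((x , y) : X × Y) → P x × Q y)
    PQ? (x , y) = P? x ×-dec Q? y
    row : P x → ∀ ys → count PQ? (map (x ,_) ys) ≡ count Q? ys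
    row px [] = refl
    row px (y ∷ ys) = step (Q? y)
      where
      step : _ → count PQ? ((x , y) ∷ map (x ,_) ys) ≡ count Q? (y ∷ ys)
      step (yes qy) = trans (count-accept PQ? (px , qy)) (trans (cong suc (row px ys)) (sym (count-accept Q? qy)))
      step (no ¬qy) = trans (count-reject PQ? (λ pq → ¬qy (proj₂ pq))) (trans (row px ys) (sym (count-reject Q? ¬qy)))
    no-row : ¬ P x → ∀ ys → count PQ? (map (x ,_) ys) ≡ 0
    no-row ¬px [] = refl
    no-row ¬px (y ∷ ys) = trans (count-reject PQ? (λ pq → ¬px (proj₁ pq))) (no-row ¬px ys)
    ih = count-product P? Q? xs ys
    by-cases : _ → count PQ? (map (x ,_) ys) + count PQ? (cartesianProduct xs ys) ≡ count P? (x ∷ xs) * count Q? ys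
    by-cases (yes px) = trans (cong₂ _+_ (row px ys) ih) (cong (_* count Q? ys) (sym (count-accept P? px)))
    by-cases (no ¬px) = trans (cong₂ _+_ (no-row ¬px ys) ih) (cong (_* count Q? ys) (sym (count-reject P? ¬px)))

  length-cartesianProduct : (xs : List X) (ys : List Y) → length (cartesianProduct xs ys) ≡ length xs * length ys
  length-cartesianProduct []       ys = refl
  length-cartesianProduct (x ∷ xs) ys =
    trans (length-++ (map (x ,_) ys)) (cong₂ _+_ (length-map (x ,_) ys) (length-cartesianProduct xs ys))

  -- The slack e, the distance to the first possible hit, makes the induction on n go through.
  count-separated : (P? : Decidable P) (d : ℕ) → (∀ {i j} → P i → P j → i < j → i + d ≤ j) →
                    ∀ n a e → e ≤ d → (∀ {j} → a ≤ j → P j → a + e ≤ j) → count P? (range a n) * d + e ≤ n + d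
  count-separated P? d sep zero a e e≤d first = e≤d
  count-separated {P} P? d sep (suc n) a e e≤d first with P? a
  ... | no ¬pa = miss e e≤d first
    where
    miss : ∀ e → e ≤ d → (∀ {j} → a ≤ j → P j → a + e ≤ j) → count P? (range (suc a) n) * d + e ≤ suc n + d
    miss zero e≤d first = ≤-trans (count-separated P? d sep n (suc a) 0 z≤n (λ {j} a<j _ → subst (_≤ j) (sym (+-identityʳ (suc a))) a<j)) (n≤1+n _)
    miss (suc e) e≤d first = subst (_≤ suc n + d) (sym (+-suc _ e))
      (s≤s (count-separated P? d sep n (suc a) e (<⇒≤ e≤d) (λ {j} a<j pj → subst (_≤ j) (+-suc a e) (first (<⇒≤ a<j) pj))))
  ... | yes pa with e | d | first ≤-refl pa | sep
  ... | suc e′ | _ | bad | _ = contradiction (m+1+n≰m a bad) (λ ())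
  ... | zero | zero | _ | _ = subst (_≤ suc n + 0) (sym (trans (+-identityʳ _) (*-zeroʳ (suc (count P? (range (suc a) n)))))) z≤n
  -- A hit at `a` pushes the next one to `a + d` or beyond; seen from `suc a` the new slack is
  -- `d′ = d ∸ 1`.
  ... | zero | suc d′ | _ | sep = subst (_≤ suc n + suc d′) (eq (count P? (range (suc a) n)) d′)
      (s≤s (count-separated P? (suc d′) sep n (suc a) d′ (n≤1+n d′) (λ {j} a<j pj → subst (_≤ j) (+-suc a d′) (sep pa pj a<j))))
    where
    eq : ∀ c d → suc (c * suc d + d) ≡ suc c * suc d + 0
    eq = solve-∀

  -- The estimate Σ 1/d² ≤ 1/k over d > k, with denominators cleared. The induction step is 1/(k+1)²
  -- + 1/(k+1) ≤ 1/k, that is, k (k + 2) ≤ (k + 1)².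
  tail-sum : (f : ℕ → ℕ) (B : ℕ) → ∀ m k → (∀ d → k < d → d ≤ k + m → d * d * f d ≤ B) →
             k * sum (map f (range (suc k) m)) ≤ B
  tail-sum f B zero k h = subst (_≤ B) (sym (*-zeroʳ k)) z≤n
  tail-sum f B (suc m) k h = *-cancelˡ-≤ (suc k * suc k) (begin
    suc k * suc k * (k * (F + S))                 ≡⟨ e₁ k F S ⟩
    k * (suc k * suc k * F) + k * suc k * (suc k * S) ≤⟨ +-mono-≤ (*-monoʳ-≤ k hF) (*-monoʳ-≤ (k * suc k) ih) ⟩
    k * B + k * suc k * B                         ≤⟨ m≤m+n _ B ⟩
    k * B + k * suc k * B + B                     ≡⟨ e₂ k B ⟩
    suc k * suc k * B                             ∎)
    where
    open ≤-Reasoning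
    F = f (suc k)
    S = sum (map f (range (suc (suc k)) m))
    hF = h (suc k) ≤-refl (subst (suc k ≤_) (sym (+-suc k m)) (s≤s (m≤m+n k m)))
    ih = tail-sum f B m (suc k) (λ d k<d d≤ → h d (<⇒≤ k<d) (subst (d ≤_) (sym (+-suc k m)) d≤))
    e₁ : ∀ k F S → suc k * suc k * (k * (F + S)) ≡ k * (suc k * suc k * F) + k * suc k * (suc k * S)
    e₁ = solve-∀
    e₂ : ∀ k B → k * B + k * suc k * B + B ≡ suc k * suc k * B
    e₂ = solve-∀

  -- The pairs (i, j) with a common divisor d of 1 + L i and 1 + L j number at most (3 n / d)², and Σ_{d > 18} (3/d)² ≤ 1/2:
  -- hence the assumption that every d < 19 divides L.
  module Progression (L : ℕ) (small : ∀ d → 0 < d → d < 19 → d ∣ L) where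

    term : ℕ → ℕ
    term i = suc (L * i)

    CoprimePair : ℕ × ℕ → Set
    CoprimePair (i , j) = Coprime (term i) (term j)

    coprimePair? : Decidable CoprimePair
    coprimePair? (i , j) = coprime? (term i) (term j)

    -- The second range is disjoint from the first, so a common divisor of 1 + L i and 1 + L j divides j ∸ i > 0.
    window : ℕ → List (ℕ × ℕ)
    window n = cartesianProduct (range n n) (range (n + n) n)

    coprimePairs : ℕ → List (ℕ × ℕ)
    coprimePairs n = filter coprimePair? (window n)

    ∣term⇒coprime : ∀ {d} i → d ∣ term i → Coprime d L
    ∣term⇒coprime {d} i d∣t {g} (g∣d , g∣L) = ∣1⇒≡1 (∣m+n∣m⇒∣n {m = L * i} (subst (g ∣_) (+-comm 1 (L * i)) (∣-trans g∣d d∣t)) (∣m⇒∣m*n i g∣L))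

    -- The two terms differ by `L * (j ∸ i)`, and a divisor of a term is coprime to `L`.
    ∣terms⇒∣diff : ∀ {d i j} → d ∣ term i → d ∣ term j → i < j → d ∣ j ∸ i
    ∣terms⇒∣diff {d} {i} {j} di dj i<j = Coprimality.coprime-divisor (∣term⇒coprime i di)
      (∣m+n∣m⇒∣n (subst (d ∣_) eq dj) di)
      where
      eq : term j ≡ term i + L * (j ∸ i)
      eq = cong suc (trans (cong (L *_) (sym (m+[n∸m]≡n (<⇒≤ i<j)))) (*-distribˡ-+ L i (j ∸ i)))

    -- By `∣terms⇒∣diff` the indices of two terms divisible by `d` are at least `d` apart; the slack
    -- starts at 0.
    hits-bound : ∀ d n a → count (λ i → d ∣? term i) (range a n) * d ≤ n + d
    hits-bound d n a = subst (_≤ n + d) (+-identityʳ _)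
      (count-separated (λ i → d ∣? term i) d sep n a 0 z≤n (λ {j} a≤j _ → subst (_≤ j) (sym (+-identityʳ a)) a≤j))
      where
      sep : ∀ {i j} → d ∣ term i → d ∣ term j → i < j → i + d ≤ j
      sep {i} {j} di dj i<j = begin
        i + d       ≤⟨ +-monoʳ-≤ i (∣⇒≤ {{>-nonZero (m<n⇒0<n∸m i<j)}} (∣terms⇒∣diff di dj i<j)) ⟩
        i + (j ∸ i) ≡⟨ m+[n∸m]≡n (<⇒≤ i<j) ⟩
        j           ∎
        where open ≤-Reasoning

    -- For a pair that is not coprime the gcd itself serves as `d`; the range runs from 19 to 2 n.
    cover : ∀ n {p} → p ∈ window n →
            CoprimePair p ⊎ (∃ λ d → d ∈ range 19 (n + n ∸ 18) × (d ∣ term (proj₁ p) × d ∣ term (proj₂ p)))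
    cover n {i , j} p∈ with coprimePair? (i , j)
    ... | yes c = inj₁ c
    ... | no ¬c = inj₂ (g , ∈-range⁺ 19 (n + n ∸ 18) 19≤g g< , g∣i , g∣j)
      where
      g = gcd (term i) (term j)
      g∣i = gcd[m,n]∣m (term i) (term j)
      g∣j = gcd[m,n]∣n (term i) (term j)
      i∈ = ∈-range⁻ n n (proj₁ (∈-cartesianProduct⁻ (range n n) _ p∈))
      j∈ = ∈-range⁻ (n + n) n (proj₂ (∈-cartesianProduct⁻ (range n n) _ p∈))
      i<j : i < j
      i<j = ≤-trans (proj₂ i∈) (proj₁ j∈)
      g>0 : 0 < g
      g>0 = n≢0⇒n>0 (λ g≡0 → contradiction (0∣⇒≡0 (subst (_∣ term i) g≡0 g∣i)) (λ ()))
      19≤g : 19 ≤ g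
      -- `g` is coprime to `L`; below 19 it would divide `L` and therefore equal 1.
      19≤g = ≮⇒≥ (λ g<19 → ¬c (Coprimality.gcd≡1⇒coprime (∣term⇒coprime i g∣i (∣-refl , small g g>0 g<19))))
      g< : g < 19 + (n + n ∸ 18)
      -- `g` divides `j ∸ i`, which is below 2 n because `i ≥ n` and `j < 3 n`.
      g< = begin-strict
        g           ≤⟨ ∣⇒≤ {{>-nonZero (m<n⇒0<n∸m i<j)}} (∣terms⇒∣diff g∣i g∣j i<j) ⟩
        j ∸ i       ≤⟨ ∸-monoʳ-≤ j (proj₁ i∈) ⟩
        j ∸ n       <⟨ ∸-monoˡ-< (proj₂ j∈) (≤-trans (m≤m+n n n) (proj₁ j∈)) ⟩
        n + n + n ∸ n ≡⟨ m+n∸n≡m (n + n) n ⟩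
        n + n       ≤⟨ m≤n+m∸n (n + n) 18 ⟩
        18 + (n + n ∸ 18) ≤⟨ n≤1+n _ ⟩
        19 + (n + n ∸ 18) ∎
        where open ≤-Reasoning

    private
      hits : ℕ → ℕ → ℕ → ℕ
      hits n a d = count (λ i → d ∣? term i) (range a n)

    -- Since `d ≤ 2 n`, each factor `n + d` coming from `hits-bound` is at most 3 n.
    hits-square : ∀ n d → 18 < d → d ≤ 18 + (n + n ∸ 18) → d * d * (hits n n d * hits n (n + n) d) ≤ 9 * (n * n)
    hits-square n d 18<d d≤ = begin
      d * d * (hits n n d * hits n (n + n) d)       ≡⟨ eq₁ d (hits n n d) (hits n (n + n) d) ⟩
      hits n n d * d * (hits n (n + n) d * d)       ≤⟨ *-mono-≤ (hits-bound d n n) (hits-bound d n (n + n)) ⟩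
      (n + d) * (n + d)                             ≤⟨ *-mono-≤ (+-monoʳ-≤ n d≤2n) (+-monoʳ-≤ n d≤2n) ⟩
      (n + (n + n)) * (n + (n + n))                 ≡⟨ eq₂ n ⟩
      9 * (n * n)                                   ∎
      where
      open ≤-Reasoning
      eq₁ : ∀ d x y → d * d * (x * y) ≡ x * d * (y * d)
      eq₁ = solve-∀
      eq₂ : ∀ n → (n + (n + n)) * (n + (n + n)) ≡ 9 * (n * n)
      eq₂ = solve-∀
      -- The two bounds on `d` force the truncated difference to be positive, hence a true
      -- difference.
      0<m : 0 < n + n ∸ 18
      0<m = +-cancelˡ-< 18 0 _ (≤-trans 18<d d≤)
      d≤2n : d ≤ n + n
      d≤2n = subst (d ≤_) (m+[n∸m]≡n (<⇒≤ (m<n∸o⇒o+m<n 0<m))) d≤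
        where
        m<n∸o⇒o+m<n : 0 < n + n ∸ 18 → 18 < n + n
        m<n∸o⇒o+m<n 0<m = m∸n≢0⇒n<m (λ eq → <⇒≢ 0<m (sym eq))

    -- By `tail-sum` with `k = 18` the bad pairs number at most 9 n² / 18 = n² / 2, so at least half
    -- of the window survives.
    coprimePairs-dense : ∀ n → n * n ≤ 2 * length (coprimePairs n)
    coprimePairs-dense n = *-cancelˡ-≤ 9 (+-cancelˡ-≤ (9 * (n * n)) _ _ (begin
      9 * (n * n) + 9 * (n * n)                    ≡⟨ eq₁ (n * n) ⟩
      18 * (n * n)                                 ≤⟨ *-monoʳ-≤ 18 total ⟩
      18 * (G + S)                                 ≡⟨ *-distribˡ-+ 18 G S ⟩
      18 * G + 18 * S                              ≤⟨ +-monoʳ-≤ (18 * G) (tail-sum _ (9 * (n * n)) (n + n ∸ 18) 18 (hits-square n)) ⟩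
      18 * G + 9 * (n * n)                         ≡⟨ eq₂ G (n * n) ⟩
      9 * (n * n) + 9 * (2 * G)                    ∎))
      where
      open ≤-Reasoning
      G = length (coprimePairs n)
      S = sum (map (λ d → hits n n d * hits n (n + n) d) (range 19 (n + n ∸ 18)))
      eq₁ : ∀ x → 9 * x + 9 * x ≡ 18 * x
      eq₁ = solve-∀
      eq₂ : ∀ x y → 18 * x + 9 * y ≡ 9 * y + 9 * (2 * x)
      eq₂ = solve-∀
      total : n * n ≤ G + S
      total = begin
        n * n           ≡⟨ cong₂ _*_ (length-range n n) (length-range (n + n) n) ⟨
        length (range n n) * length (range (n + n) n) ≡⟨ length-cartesianProduct (range n n) (range (n + n) n) ⟨
        length (window n) ≤⟨ union-bound coprimePair? (λ d (i , j) → (d ∣? term i) ×-dec (d ∣? term j)) (range 19 (n + n ∸ 18)) (window n) (cover n) ⟩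
        G + sum (map (λ d → count (λ (i , j) → (d ∣? term i) ×-dec (d ∣? term j)) (window n)) (range 19 (n + n ∸ 18)))
                        ≡⟨ cong (λ x → G + sum x) (map-cong (λ d → count-product (λ i → d ∣? term i) (λ j → d ∣? term j) (range n n) (range (n + n) n)) (range 19 (n + n ∸ 18))) ⟩
        G + S           ∎

    coprimePairs-unique : ∀ n → Unique (coprimePairs n)
    coprimePairs-unique n = Unique.filter⁺ coprimePair? (Unique.cartesianProduct⁺ (range-unique n n) (range-unique (n + n) n))

    ∈-coprimePairs⁻ : ∀ n {i j} → (i , j) ∈ coprimePairs n → (n ≤ i × i < n + n) × j < n + n + n × Coprime (term i) (term j)
    ∈-coprimePairs⁻ n p∈ with ∈-filter⁻ coprimePair? {xs = window n} p∈
    ... | p∈w , c with ∈-cartesianProduct⁻ (range n n) (range (n + n) n) p∈w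
    ... | i∈ , j∈ = ∈-range⁻ n n i∈ , proj₂ (∈-range⁻ (n + n) n j∈) , c

    -- Dyadic levels of quadruples.

    block : ℕ → ℕ → List ((ℕ × ℕ) × (ℕ × ℕ))
    block E l = cartesianProduct (coprimePairs (2 ^ l)) (coprimePairs (2 ^ (E ∸ l)))

    -- On every level an entry of the first pair times an entry of the second has index size about
    -- `2 ^ E`, so all `suc E` levels reach the same height.
    quadruples : ℕ → List ((ℕ × ℕ) × (ℕ × ℕ))
    quadruples E = concat (map (block E) (range 0 (suc E)))

    block-dense : ∀ E l → l ≤ E → 2 ^ E * 2 ^ E ≤ 4 * length (block E l)
    block-dense E l l≤E = begin
      2 ^ E * 2 ^ E                        ≡⟨ cong (λ x → x * x) split ⟩
      (a * b) * (a * b)                    ≡⟨ eq₁ a b ⟩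
      (a * a) * (b * b)                    ≤⟨ *-mono-≤ (coprimePairs-dense a) (coprimePairs-dense b) ⟩
      (2 * x) * (2 * y)                    ≡⟨ eq₂ x y ⟩
      4 * (x * y)                          ≡⟨ cong (4 *_) (length-cartesianProduct (coprimePairs a) (coprimePairs b)) ⟨
      4 * length (block E l)               ∎
      where
      open ≤-Reasoning
      a = 2 ^ l
      b = 2 ^ (E ∸ l)
      x = length (coprimePairs a)
      y = length (coprimePairs b)
      split : 2 ^ E ≡ a * b
      split = trans (cong (2 ^_) (sym (m+[n∸m]≡n l≤E))) (^-distribˡ-+-* 2 l (E ∸ l))
      eq₁ : ∀ a b → (a * b) * (a * b) ≡ (a * a) * (b * b)
      eq₁ = solve-∀
      eq₂ : ∀ x y → (2 * x) * (2 * y) ≡ 4 * (x * y)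
      eq₂ = solve-∀

    quadruples-many : ∀ E → suc E * (2 ^ E * 2 ^ E) ≤ 4 * length (quadruples E)
    quadruples-many E = go 0 (suc E) ≤-refl
      where
      open ≤-Reasoning
      go : ∀ a m → a + m ≤ suc E → m * (2 ^ E * 2 ^ E) ≤ 4 * length (concat (map (block E) (range a m)))
      go a zero    _ = z≤n
      go a (suc m) h = begin
        2 ^ E * 2 ^ E + m * (2 ^ E * 2 ^ E)             ≤⟨ +-mono-≤ (block-dense E a (≤-trans (m≤m+n a m) (≤-pred h′))) (go (suc a) m h′) ⟩
        4 * length (block E a) + 4 * length rest        ≡⟨ *-distribˡ-+ 4 (length (block E a)) (length rest) ⟨
        4 * (length (block E a) + length rest)          ≡⟨ cong (4 *_) (length-++ (block E a)) ⟨
        4 * length (block E a ++ rest)                  ∎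
        where
        rest = concat (map (block E) (range (suc a) m))
        h′ : suc a + m ≤ suc E
        h′ = subst (_≤ suc E) (+-suc a m) h

    -- Distinct blocks are disjoint because the first index lies between `2 ^ l` (included) and
    -- `2 ^ suc l` (excluded), which determines `l`.
    quadruples-unique : ∀ E → Unique (quadruples E)
    quadruples-unique E = Unique.concat⁺ (blocks-unique (range 0 (suc E)))
      (AllPairs.map⁺ {f = block E} (AllPairs.map disjoint (range-unique 0 (suc E))))
      where
      blocks-unique : ∀ ls → All Unique (map (block E) ls)
      blocks-unique []       = []
      blocks-unique (l ∷ ls) =
        Unique.cartesianProduct⁺ (coprimePairs-unique (2 ^ l)) (coprimePairs-unique (2 ^ (E ∸ l))) ∷ blocks-unique ls
      first : ∀ l {i j k m} → ((i , j) , (k , m)) ∈ block E l → 2 ^ l ≤ i × i < 2 ^ suc l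
      first l {i} q∈ with ∈-coprimePairs⁻ (2 ^ l) (proj₁ (∈-cartesianProduct⁻ (coprimePairs (2 ^ l)) _ q∈))
      ... | (lo , hi) , _ = lo , subst (i <_) (cong (2 ^ l +_) (sym (+-identityʳ (2 ^ l)))) hi
      level-≤ : ∀ {l l′ i} → 2 ^ l ≤ i → i < 2 ^ suc l′ → l ≤ l′
      level-≤ {l} {l′} lo hi = ≮⇒≥ (λ l′<l → <⇒≱ hi (≤-trans (^-monoʳ-≤ 2 l′<l) lo))
      disjoint : ∀ {l l′} → l ≢ l′ → Disjoint (block E l) (block E l′)
      disjoint {l} {l′} l≢l′ {(i , j) , (k , m)} (q∈ , q∈′) with first l q∈ | first l′ q∈′
      ... | lo , hi | lo′ , hi′ = l≢l′ (≤-antisym (level-≤ lo hi′) (level-≤ lo′ hi))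

    -- Forgets the level: `m` and `n` stand for `2 ^ e` and `2 ^ (E ∸ e)`, and the height bounds
    -- depend only on their product. The factor 3 covers both ranges of a window.
    record Admissible (E i j k l : ℕ) : Set where
      field
        {m n}  : ℕ
        m*n≡2^E : m * n ≡ 2 ^ E
        m>0 : 0 < m
        n>0 : 0 < n
        i≤3m : i ≤ 3 * m
        j≤3m : j ≤ 3 * m
        k≤3n : k ≤ 3 * n
        l≤3n : l ≤ 3 * n
        coprime-ij : Coprime (term i) (term j)
        coprime-kl : Coprime (term k) (term l)

    ∈-quadruples⁻ : ∀ E {i j k l} → ((i , j) , (k , l)) ∈ quadruples E → Admissible E i j k l
    ∈-quadruples⁻ E {i} {j} {k} {l} q∈ with ∈-concat⁻′ (map (block E) (range 0 (suc E))) q∈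
    ... | _ , q∈b , b∈ with ∈-map⁻ (block E) b∈
    ... | e , e∈ , refl with ∈-cartesianProduct⁻ (coprimePairs (2 ^ e)) (coprimePairs (2 ^ (E ∸ e))) q∈b
    ... | ij∈ , kl∈ with ∈-coprimePairs⁻ (2 ^ e) ij∈ | ∈-coprimePairs⁻ (2 ^ (E ∸ e)) kl∈
    ... | (_ , i<) , j< , cij | (_ , k<) , l< , ckl = record
      { m*n≡2^E = trans (sym (^-distribˡ-+-* 2 e (E ∸ e))) (cong (2 ^_) (m+[n∸m]≡n (≤-pred (proj₂ (∈-range⁻ 0 (suc E) e∈)))))
      ; m>0 = m^n>0 2 e
      ; n>0 = m^n>0 2 (E ∸ e)
      ; i≤3m = 2-3 (2 ^ e) i<
      ; j≤3m = 3-3 (2 ^ e) j<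
      ; k≤3n = 2-3 (2 ^ (E ∸ e)) k<
      ; l≤3n = 3-3 (2 ^ (E ∸ e)) l<
      ; coprime-ij = cij
      ; coprime-kl = ckl
      }
      where
      eq : ∀ a → a + a + a ≡ 3 * a
      eq = solve-∀
      3-3 : ∀ a {x} → x < a + a + a → x ≤ 3 * a
      3-3 a {x} x< = <⇒≤ (subst (x <_) (eq a) x<)
      2-3 : ∀ a {x} → x < a + a → x ≤ 3 * a
      2-3 a x< = 3-3 a (<-≤-trans x< (m≤m+n (a + a) a))

  -- One occurrence of `f x` is removed from `ys`; by injectivity and uniqueness the images of the
  -- other elements remain in the rest.
  injection⇒length≤ : (f : A → X) {xs : List A} (ys : List X) → Unique xs →
    (∀ {x} → x ∈ xs → f x ∈ ys) → (∀ {x y} → x ∈ xs → y ∈ xs → f x ≡ f y → x ≡ y) → length xs ≤ length ys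
  injection⇒length≤ f {[]} ys [] into inj = z≤n
  injection⇒length≤ f {x ∷ xs} ys (x∉ ∷ uniq) into inj with ∈-∃++ (into (here refl))
  ... | as , bs , refl = begin
    suc (length xs)              ≤⟨ s≤s (injection⇒length≤ f (as ++ bs) uniq into′ (λ y∈ z∈ → inj (there y∈) (there z∈))) ⟩
    suc (length (as ++ bs))      ≡⟨ cong suc (length-++ as) ⟩
    suc (length as + length bs)  ≡⟨ +-suc (length as) (length bs) ⟨
    length as + suc (length bs)  ≡⟨ length-++ as ⟨
    length (as ++ f x ∷ bs)      ∎
    where
    open ≤-Reasoning
    into′ : ∀ {y} → y ∈ xs → f y ∈ as ++ bs
    into′ {y} y∈ with ∈-++⁻ as (into (there y∈))
    ... | inj₁ ∈as         = ∈-++⁺ˡ ∈as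
    ... | inj₂ (here eq)   = ⊥-elim (All.lookup x∉ y∈ (sym (inj (there y∈) (here refl) eq)))
    ... | inj₂ (there ∈bs) = ∈-++⁺ʳ as ∈bs

module IntegerPoints where

  open import Data.Nat using (zero; suc; _<_; z≤n; s≤s)
  import Data.Nat as ℕ
  import Data.Nat.Properties as ℕ
  import Data.Nat.Divisibility as ℕ
  import Data.Nat.DivMod as ℕ using (m≡m%n+[m/n]*n; m%n<n; m≥n⇒m/n>0)
  import Data.Nat.Tactic.RingSolver as ℕ
  open import Data.Nat.Induction using (<-rec)
  open import Data.Nat.Logarithm using (⌊log₂⌋-mono-≤; ⌊log₂[2^n]⌋≡n)
  open import Data.Nat.Primality using (Prime; prime?; prime[2]; ¬prime[1]; euclidsLemma; prime⇒nonZero; prime⇒irreducible)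
  open import Data.Nat.Primality.Factorisation using (factorise)
  open import Data.Fin using (Fin; toℕ; fromℕ<)
  open import Data.Fin.Properties using (any?; toℕ-fromℕ<)
  open import Data.Integer using (+_; -[1+_]; 0ℤ; 1ℤ; -1ℤ; _+_; _*_; _-_; -_; ∣_∣; ≢-nonZero; _◃_; sign; _≟_)
  open import Data.Integer.Properties hiding (≤-trans; ≤-refl; ≤-reflexive; _≟_)
  open import Data.Integer.Divisibility.Signed renaming (_∣_ to _∣ᶻ_)
  open import Data.Integer.Tactic.RingSolver using (solve-∀)
  import Data.Sign as Sign

  -- Divisibility and squareful numbers

  ι : ℕ → ℤ
  ι n = + n

  infixl 8 _²
  _² : ℤ → ℤ
  x ² = x * x

  prime-divisor : ∀ n → n ≢ 1 → ∃ λ p → Prime p × p ℕ.∣ n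
  prime-divisor zero n≢1 = 2 , prime[2] , ℕ.divides 0 refl
  prime-divisor n@(suc _) n≢1 with factorise n
  ... | record { factors = [] ; isFactorisation = n≡1 } = contradiction n≡1 n≢1
  ... | record { factors = p ∷ ps ; isFactorisation = n≡ ; factorsPrime = pr ∷ _ } =
    p , pr , subst (p ℕ.∣_) (sym n≡) (ℕ.m∣m*n _)

  coprime-by-primes : ∀ {m n} → (∀ {p} → Prime p → p ℕ.∣ m → p ℕ.∣ n → ⊥) → Coprime m n
  coprime-by-primes {m} {n} none {d} (d∣m , d∣n) with d ℕ.≟ 1
  ... | yes d≡1 = d≡1
  ... | no d≢1 with prime-divisor d d≢1
  ... | p , pr , p∣d = ⊥-elim (none pr (ℕ.∣-trans p∣d d∣m) (ℕ.∣-trans p∣d d∣n))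

  prime∤1 : ∀ {p} → Prime p → ¬ p ℕ.∣ 1
  prime∤1 pr p∣1 = ¬prime[1] (subst Prime (ℕ.∣1⇒≡1 p∣1) pr)

  euclid : ∀ {p} → Prime p → ∀ m n → + p ∣ᶻ m * n → (+ p ∣ᶻ m) ⊎ (+ p ∣ᶻ n)
  euclid {p} pr m n p∣mn with euclidsLemma ∣ m ∣ ∣ n ∣ pr (subst (p ℕ.∣_) (abs-* m n) (∣⇒∣ᵤ p∣mn))
  ... | inj₁ p∣m = inj₁ (∣ᵤ⇒∣ p∣m)
  ... | inj₂ p∣n = inj₂ (∣ᵤ⇒∣ p∣n)

  euclid-sq : ∀ {p} → Prime p → ∀ m → + p ∣ᶻ m ² → + p ∣ᶻ m
  euclid-sq pr m p∣m² = [ (λ x → x) , (λ x → x) ]′ (euclid pr m m p∣m²)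

  *-≢0 : ∀ {m n} → m ≢ 0ℤ → n ≢ 0ℤ → m * n ≢ 0ℤ
  *-≢0 {m} m≢0 n≢0 mn≡0 = [ m≢0 , n≢0 ]′ (i*j≡0⇒i≡0∨j≡0 m mn≡0)

  ≢0-*ˡ : ∀ {m n} → m * n ≢ 0ℤ → m ≢ 0ℤ
  ≢0-*ˡ {n = n} mn≢0 refl = mn≢0 refl

  ≢0-*ʳ : ∀ {m n} → m * n ≢ 0ℤ → n ≢ 0ℤ
  ≢0-*ʳ {m} mn≢0 refl = mn≢0 (*-zeroʳ m)

  *-cancelˡ : ∀ k {m n} → k ≢ 0ℤ → k * m ≡ k * n → m ≡ n
  *-cancelˡ k {m} {n} k≢0 eq = *-cancelˡ-≡ k m n {{≢-nonZero k≢0}} eq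

  square-injective : ∀ x y → x ² ≡ y ² → x ≡ y ⊎ x + y ≡ 0ℤ
  square-injective x y eq =
    [ (λ x-y≡0 → inj₁ (i-j≡0⇒i≡j x y x-y≡0)) , inj₂ ]′ (i*j≡0⇒i≡0∨j≡0 (x - y) {x + y} (trans (factor x y) (i≡j⇒i-j≡0 {x ²} {y ²} eq)))
    where
    factor : ∀ x y → (x - y) * (x + y) ≡ x * x - y * y
    factor = solve-∀

  Squarefulℕ-* : ∀ {m n} → Squarefulℕ m → Squarefulℕ n → Squarefulℕ (m ℕ.* n)
  Squarefulℕ-* {m} {n} sm sn p pr p∣mn with euclidsLemma m n pr p∣mn
  ... | inj₁ p∣m = ℕ.∣m⇒∣m*n n (sm p pr p∣m)
  ... | inj₂ p∣n = ℕ.∣n⇒∣m*n m (sn p pr p∣n)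

  Squareful-* : ∀ {x y} → Squareful x → Squareful y → Squareful (x * y)
  Squareful-* {x} {y} sx sy = subst Squarefulℕ (sym (abs-* x y)) (Squarefulℕ-* sx sy)

  Squareful-² : ∀ x → Squareful (x ²)
  Squareful-² x p pr p∣x² rewrite abs-* x x = [ p²∣x² , p²∣x² ]′ (euclidsLemma (∣ x ∣) (∣ x ∣) pr p∣x²)
    where
    p²∣x² : p ℕ.∣ ∣ x ∣ → p ℕ.^ 2 ℕ.∣ ∣ x ∣ ℕ.* ∣ x ∣
    p²∣x² p∣x = subst (ℕ._∣ ∣ x ∣ ℕ.* ∣ x ∣) (cong (p ℕ.*_) (sym (ℕ.*-identityʳ p))) (ℕ.*-pres-∣ p∣x p∣x)

  Squareful-³ : ∀ x → Squareful (x ² * x)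
  Squareful-³ x p pr p∣x³ = subst (p ℕ.^ 2 ℕ.∣_) (sym (abs-* (x ²) x))
    (ℕ.∣m⇒∣m*n ∣ x ∣ (Squareful-² x p pr (∣⇒∣ᵤ (∣m⇒∣m*n x p∣x))))
    where
    p∣x : + p ∣ᶻ x
    p∣x = [ euclid-sq pr x , (λ h → h) ]′ (euclid pr (x ²) x (∣ᵤ⇒∣ p∣x³))

  1+multiple∤ : ∀ {p d} c x → Prime p → + p ∣ᶻ d → ¬ (+ p ∣ᶻ 1ℤ + d * c * x)
  1+multiple∤ {p} {d} c x pr p∣d p∣z =
    prime∤1 pr (∣⇒∣ᵤ (∣m+n∣n⇒∣m {+ p} {1ℤ} {d * c * x} p∣z (∣m⇒∣m*n {+ p} {d * c} x (∣m⇒∣m*n {+ p} {d} c p∣d))))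

  3∣remainder : ∀ {m x} → + 3 ∣ᶻ x → + m + x ≡ 0ℤ → 3 ℕ.∣ m
  3∣remainder {m} {x} 3∣x eq = ∣⇒∣ᵤ {+ 3} {+ m} (∣m+n∣n⇒∣m {+ 3} {+ m} {x} (subst (+ 3 ∣ᶻ_) (sym eq) (divides 0ℤ refl)) 3∣x)

  1+multiple≢0 : ∀ {d} c x → + 3 ∣ᶻ d → 1ℤ + d * c * x ≢ 0ℤ
  1+multiple≢0 {d} c x 3∣d eq = contradiction (ℕ.∣1⇒≡1 (3∣remainder {1} {d * c * x}
    (∣m⇒∣m*n {+ 3} {d * c} x (∣m⇒∣m*n {+ 3} {d} c 3∣d)) eq)) (λ ())

  -- Otherwise the two numbers are opposite, and their sum, which is 2 modulo 3, would vanish.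
  1+multiple-square-injective : ∀ {d} c x y → + 3 ∣ᶻ d → (1ℤ + d * c * x) ² ≡ (1ℤ + d * c * y) ² → 1ℤ + d * c * x ≡ 1ℤ + d * c * y
  1+multiple-square-injective {d} c x y 3∣d eq =
    [ (λ same → same) , (λ opposite → contradiction opposite not-opposite) ]′ (square-injective (1ℤ + d * c * x) (1ℤ + d * c * y) eq)
    where
    e : ∀ d c x y → (1ℤ + d * c * x) + (1ℤ + d * c * y) ≡ + 2 + d * c * (x + y)
    e = solve-∀
    not-opposite : (1ℤ + d * c * x) + (1ℤ + d * c * y) ≢ 0ℤ
    not-opposite opposite = contradiction (ℕ.∣⇒≤ (3∣remainder {2} {d * c * (x + y)} (∣m⇒∣m*n {+ 3} {d * c} (x + y) (∣m⇒∣m*n {+ 3} {d} c 3∣d))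
      (trans (sym (e d c x y)) opposite))) λ { (s≤s (s≤s ())) }

  infix 4 _⟂_
  -- Coprimality over ℤ as a Bézout identity: signs need no care, and closure under products follows
  -- by multiplying identities.
  _⟂_ : ℤ → ℤ → Set
  m ⟂ n = Σ ℤ λ s → Σ ℤ λ t → s * m + t * n ≡ 1ℤ

  Squareful-*² : ∀ {x} z → Squareful x → Squareful (x * z ²)
  Squareful-*² {x} z sx = Squareful-* {x} {z ²} sx (Squareful-² z)

  *²-injective : ∀ {a z z′} → a ≢ 0ℤ → a * z ² ≡ a * z′ ² → z ² ≡ z′ ²
  *²-injective {a} a≢0 = *-cancelˡ a a≢0

  ∣*²⇒∣ : ∀ {p a z} → Prime p → ¬ (+ p ∣ᶻ a) → + p ∣ᶻ a * z ² → + p ∣ᶻ z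
  ∣*²⇒∣ {a = a} {z} pr p∤a p∣ = [ (λ p∣a → contradiction p∣a p∤a) , euclid-sq pr z ]′ (euclid pr a (z ²) p∣)

  ∣*²⇒∣′ : ∀ {p a z} → Prime p → ¬ (+ p ∣ᶻ z) → + p ∣ᶻ a * z ² → + p ∣ᶻ a
  ∣*²⇒∣′ {a = a} {z} pr p∤z p∣ = [ (λ p∣a → p∣a) , (λ p∣z² → contradiction (euclid-sq pr z p∣z²) p∤z) ]′ (euclid pr a (z ²) p∣)

  ⟂-no-common-prime : ∀ {p m n} → Prime p → m ⟂ n → + p ∣ᶻ m → + p ∣ᶻ n → ⊥
  ⟂-no-common-prime {p} {m} {n} pr (s , t , eq) p∣m p∣n = prime∤1 pr (∣⇒∣ᵤ {+ p} {1ℤ} (subst (+ p ∣ᶻ_) eq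
    (∣m∣n⇒∣m+n {+ p} {s * m} {t * n} (∣n⇒∣m*n {+ p} s p∣m) (∣n⇒∣m*n {+ p} t p∣n))))

  ∣sum∣difference : ∀ {p} d g → Prime p → ¬ (+ p ∣ᶻ + 2) → + p ∣ᶻ d + g → + p ∣ᶻ g + - d → (+ p ∣ᶻ d) × (+ p ∣ᶻ g)
  ∣sum∣difference {p} d g pr p∤2 h₊ h₋ =
    half d (subst (+ p ∣ᶻ_) (e₋ g d) (∣m∣n⇒∣m-n {+ p} {d + g} {g + - d} h₊ h₋)) ,
    half g (subst (+ p ∣ᶻ_) (e₊ g d) (∣m∣n⇒∣m+n {+ p} {d + g} {g + - d} h₊ h₋))
    where
    e₊ : ∀ g d → (d + g) + (g + - d) ≡ + 2 * g
    e₊ = solve-∀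
    e₋ : ∀ g d → (d + g) - (g + - d) ≡ + 2 * d
    e₋ = solve-∀
    half : ∀ x → + p ∣ᶻ + 2 * x → + p ∣ᶻ x
    half x p∣ = [ (λ p∣2 → contradiction p∣2 p∤2) , (λ h → h) ]′ (euclid pr (+ 2) x p∣)

  -- Sum and difference of the last two forms give that `p` divides r v and s t. Coprimality rules
  -- out `p` dividing s and v, or t and r. If `p` divides r and s, the first form puts it into t v;
  -- if it divides t and v, into r s; both contradict coprimality again.
  no-common-prime : ∀ {p} α β γ δ {r t s v} → Prime p → Coprime r t → Coprime s v →
    ¬ (+ p ∣ᶻ + 2) → ¬ (+ p ∣ᶻ α) → ¬ (+ p ∣ᶻ β) → ¬ (+ p ∣ᶻ γ) → ¬ (+ p ∣ᶻ δ) →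
    + p ∣ᶻ α * ι (t ℕ.* v) + - β * ι (r ℕ.* s) →
    + p ∣ᶻ δ * ι (r ℕ.* v) + γ * ι (s ℕ.* t) →
    + p ∣ᶻ γ * ι (s ℕ.* t) + - δ * ι (r ℕ.* v) → ⊥
  no-common-prime {p} α β γ δ {r} {t} {s} {v} pr rt sv p∤2 p∤α p∤β p∤γ p∤δ d₀ d₂ d₁ =
    by-cases (euclidsLemma s t pr p∣st) (euclidsLemma r v pr p∣rv)
    where
    unit : ∀ c n → ¬ (+ p ∣ᶻ c) → + p ∣ᶻ c * ι n → p ℕ.∣ n
    unit c n p∤c p∣ = [ (λ p∣c → contradiction p∣c p∤c) , ∣⇒∣ᵤ {+ p} {ι n} ]′ (euclid pr c (ι n) p∣)
    p∤-β : ¬ (+ p ∣ᶻ - β)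
    p∤-β p∣-β = p∤β (subst (+ p ∣ᶻ_) (neg-involutive β) (∣m⇒∣-m {+ p} { - β} p∣-β))
    both : (+ p ∣ᶻ δ * ι (r ℕ.* v)) × (+ p ∣ᶻ γ * ι (s ℕ.* t))
    both = ∣sum∣difference (δ * ι (r ℕ.* v)) (γ * ι (s ℕ.* t)) pr p∤2 d₂
      (subst (λ w → + p ∣ᶻ γ * ι (s ℕ.* t) + w) (sym (neg-distribˡ-* δ (ι (r ℕ.* v)))) d₁)
    p∣rv : p ℕ.∣ r ℕ.* v
    p∣rv = unit δ (r ℕ.* v) p∤δ (proj₁ both)
    p∣st : p ℕ.∣ s ℕ.* t
    p∣st = unit γ (s ℕ.* t) p∤γ (proj₂ both)
    not-both : ∀ {m n} → Coprime m n → p ℕ.∣ m → p ℕ.∣ n → ⊥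
    not-both c p∣m p∣n = ¬prime[1] (subst Prime (c (p∣m , p∣n)) pr)
    p∣tv : p ℕ.∣ r ℕ.* s → p ℕ.∣ t ℕ.* v
    p∣tv p∣rs = unit α (t ℕ.* v) p∤α (∣m+n∣n⇒∣m {+ p} {α * ι (t ℕ.* v)} { - β * ι (r ℕ.* s)} d₀ (∣n⇒∣m*n {+ p} (- β) {ι (r ℕ.* s)} (∣ᵤ⇒∣ {+ p} {ι (r ℕ.* s)} p∣rs)))
    p∣rs : p ℕ.∣ t ℕ.* v → p ℕ.∣ r ℕ.* s
    p∣rs p∣tv = unit (- β) (r ℕ.* s) p∤-β (∣m+n∣m⇒∣n {+ p} {α * ι (t ℕ.* v)} { - β * ι (r ℕ.* s)} d₀ (∣n⇒∣m*n {+ p} α {ι (t ℕ.* v)} (∣ᵤ⇒∣ {+ p} {ι (t ℕ.* v)} p∣tv)))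
    by-cases : p ℕ.∣ s ⊎ p ℕ.∣ t → p ℕ.∣ r ⊎ p ℕ.∣ v → ⊥
    by-cases (inj₁ p∣s) (inj₁ p∣r) = [ not-both rt p∣r , not-both sv p∣s ]′ (euclidsLemma t v pr (p∣tv (ℕ.∣m⇒∣m*n s p∣r)))
    by-cases (inj₁ p∣s) (inj₂ p∣v) = not-both sv p∣s p∣v
    by-cases (inj₂ p∣t) (inj₁ p∣r) = not-both rt p∣r p∣t
    by-cases (inj₂ p∣t) (inj₂ p∣v) = [ (λ p∣r → not-both rt p∣r p∣t) , (λ p∣s → not-both sv p∣s p∣v) ]′ (euclidsLemma r s pr (p∣rs (ℕ.∣m⇒∣m*n v p∣t)))

  -- r = gcd (r s) (r v).
  factor-recovery : ∀ {r s v r′ s′ v′} → Coprime s v → Coprime s′ v′ →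
    r ℕ.* s ≡ r′ ℕ.* s′ → r ℕ.* v ≡ r′ ℕ.* v′ → r ≡ r′
  factor-recovery {r} {s} {v} {r′} {s′} {v′} sv s′v′ rs rv =
    trans (sym (gcd-form r s v sv)) (trans (cong₂ gcd rs rv) (gcd-form r′ s′ v′ s′v′))
    where
    gcd-form : ∀ r s v → Coprime s v → gcd (r ℕ.* s) (r ℕ.* v) ≡ r
    gcd-form r s v c = trans (sym (c*gcd[m,n]≡gcd[cm,cn] r s v)) (trans (cong (r ℕ.*_) (Coprimality.coprime⇒gcd≡1 c)) (ℕ.*-identityʳ r))

  -- The family of solutions attached to a base solution

  -- `balance` is c₀a₀ + c₁a₁ + c₂a₂ = a₃ in factored form. The non-vanishing conditions keep the
  -- points non-zero, the linear change of variables invertible and the modulus non-zero.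
  record BaseSolution (c₀ c₁ c₂ : ℤ) : Set where
    field
      a₀ a₁ a₂ a₃ u θ U X y : ℤ
      a₀≢0 : a₀ ≢ 0ℤ
      a₁≢0 : a₁ ≢ 0ℤ
      a₂≢0 : a₂ ≢ 0ℤ
      a₃≢0 : a₃ ≢ 0ℤ
      squareful₀ : Squareful a₀
      squareful₁ : Squareful a₁
      squareful₂ : Squareful a₂
      squareful₃ : Squareful a₃
      coprime₀₂ : a₀ ⟂ a₂
      eq₀ : c₀ * a₀ ≡ u * X ²
      eq₁ : c₁ * a₁ ≡ - (θ * y ²)
      eq₂ : c₂ * a₂ ≡ θ
      eq₃ : a₃ ≡ u * U ²
      balance : u * ((U + X) * (U - X)) ≡ θ * ((1ℤ + y) * (1ℤ - y))
      U≢0 : U ≢ 0ℤ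
      X≢0 : X ≢ 0ℤ
      y≢0 : y ≢ 0ℤ
      U+X≢0 : U + X ≢ 0ℤ
      U-X≢0 : U - X ≢ 0ℤ
      1+y≢0 : 1ℤ + y ≢ 0ℤ
      1-y≢0 : 1ℤ - y ≢ 0ℤ

  -- The difference of the squares of δ RV ± γ ST is 4 γδ RV ST, and that of β RS ± α TV is 4 αβ RS
  -- TV; the two hypotheses match these products.
  quadric-identity : ∀ u θ α β γ δ RS TV RV ST → u * (α * β) ≡ θ * (γ * δ) → RS * TV ≡ RV * ST →
    u * (α * TV + - β * RS) ² + - (θ * (γ * ST + - δ * RV) ²) + θ * (δ * RV + γ * ST) ² ≡ u * (β * RS + α * TV) ²
  quadric-identity u θ α β γ δ RS TV RV ST balance exchange = begin
    u * (α * TV + - β * RS) ² + - (θ * (γ * ST + - δ * RV) ²) + θ * (δ * RV + γ * ST) ² ≡⟨ e₁ u θ α β γ δ RS TV RV ST ⟩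
    u * (α * TV + - β * RS) ² + + 4 * (θ * (γ * δ)) * (RV * ST) ≡⟨ cong₂ (λ a b → u * (α * TV + - β * RS) ² + + 4 * a * b) (sym balance) (sym exchange) ⟩
    u * (α * TV + - β * RS) ² + + 4 * (u * (α * β)) * (RS * TV) ≡⟨ e₂ u α β RS TV ⟩
    u * (β * RS + α * TV) ² ∎
    where
    open ≡-Reasoning
    e₁ : ∀ u θ α β γ δ RS TV RV ST →
      u * ((α * TV + - β * RS) * (α * TV + - β * RS)) + - (θ * ((γ * ST + - δ * RV) * (γ * ST + - δ * RV))) + θ * ((δ * RV + γ * ST) * (δ * RV + γ * ST))
        ≡ u * ((α * TV + - β * RS) * (α * TV + - β * RS)) + + 4 * (θ * (γ * δ)) * (RV * ST)
    e₁ = solve-∀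
    e₂ : ∀ u α β RS TV → u * ((α * TV + - β * RS) * (α * TV + - β * RS)) + + 4 * (u * (α * β)) * (RS * TV)
        ≡ u * ((β * RS + α * TV) * (β * RS + α * TV))
    e₂ = solve-∀

  -- The zᵢ will be ≡ 1 mod Λ, and 3 ∣ Λ makes zᵢ recoverable from zᵢ².
  record Modulus {c₀ c₁ c₂} (base : BaseSolution c₀ c₁ c₂) : Set where
    open BaseSolution base
    field
      Λ : ℤ
      L : ℕ
      L>0 : 0 < L
      +L≡ΛW : + L ≡ Λ * (+ 2 * (U * (X * y)))
      small∣L : ∀ d → 0 < d → d < 19 → d ℕ.∣ L
      2∣Λ : + 2 ∣ᶻ Λ
      3∣Λ : + 3 ∣ᶻ Λ
      a₀∣Λ : a₀ ∣ᶻ Λ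
      a₁∣Λ : a₁ ∣ᶻ Λ
      a₂∣Λ : a₂ ∣ᶻ Λ
      α∣Λ : U + X ∣ᶻ Λ
      β∣Λ : U - X ∣ᶻ Λ
      γ∣Λ : 1ℤ + y ∣ᶻ Λ
      δ∣Λ : 1ℤ - y ∣ᶻ Λ

  -- `Λ` is itself a multiple of `W`, so `Λ * W` contains the square of `W` and is positive whatever
  -- the sign of `W`. The factor `F` supplies the small divisors.
  modulus : ∀ {c₀ c₁ c₂} (base : BaseSolution c₀ c₁ c₂) (F : ℕ) → F ≢ 0 → (∀ d → 0 < d → d < 19 → d ℕ.∣ F) → Modulus base
  modulus base F F≢0 small = record
    { Λ = W * M
    ; L = ∣ W ∣ ℕ.* ∣ W ∣ ℕ.* (∣ P ∣ ℕ.* F)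
    ; L>0 = ℕ.n≢0⇒n>0 L≢0
    ; +L≡ΛW = +L≡ΛW
    ; small∣L = λ d d>0 d<19 → ℕ.∣n⇒∣m*n (∣ W ∣ ℕ.* ∣ W ∣) (ℕ.∣n⇒∣m*n (∣ P ∣) (small d d>0 d<19))
    ; 2∣Λ = ∣m⇒∣m*n {+ 2} {W} M (divides (U * (X * y)) (*-comm (+ 2) (U * (X * y))))
    ; 3∣Λ = ∣n⇒∣m*n {+ 3} W (∣ᵤ⇒∣ {+ 3} {M} (ℕ.∣n⇒∣m*n (∣ P ∣) (small 3 (s≤s z≤n) (s≤s (s≤s (s≤s (s≤s z≤n)))))))
    ; a₀∣Λ = ∣Λ (left (a₀ * (a₁ * a₂)) Q (left a₀ (a₁ * a₂) (∣-refl {a₀})))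
    ; a₁∣Λ = ∣Λ (left (a₀ * (a₁ * a₂)) Q (right a₀ (a₁ * a₂) (left a₁ a₂ (∣-refl {a₁}))))
    ; a₂∣Λ = ∣Λ (left (a₀ * (a₁ * a₂)) Q (right a₀ (a₁ * a₂) (right a₁ a₂ (∣-refl {a₂}))))
    ; α∣Λ = ∣Λ (right (a₀ * (a₁ * a₂)) Q (left (α * β) (γ * δ) (left α β (∣-refl {α}))))
    ; β∣Λ = ∣Λ (right (a₀ * (a₁ * a₂)) Q (left (α * β) (γ * δ) (right α β (∣-refl {β}))))
    ; γ∣Λ = ∣Λ (right (a₀ * (a₁ * a₂)) Q (right (α * β) (γ * δ) (left γ δ (∣-refl {γ}))))
    ; δ∣Λ = ∣Λ (right (a₀ * (a₁ * a₂)) Q (right (α * β) (γ * δ) (right γ δ (∣-refl {δ}))))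
    }
    where
    open BaseSolution base
    α = U + X
    β = U - X
    γ = 1ℤ + y
    δ = 1ℤ - y
    Q = (α * β) * (γ * δ)
    W = + 2 * (U * (X * y))
    P = (a₀ * (a₁ * a₂)) * Q
    M = + (∣ P ∣ ℕ.* F)
    left : ∀ {d} m n → d ∣ᶻ m → d ∣ᶻ m * n
    left {d} m n = ∣m⇒∣m*n {d} {m} n
    right : ∀ {d} m n → d ∣ᶻ n → d ∣ᶻ m * n
    right {d} m n = ∣n⇒∣m*n {d} m {n}
    ∣Λ : ∀ {d} → d ∣ᶻ P → d ∣ᶻ W * M
    ∣Λ {d} d∣P = ∣n⇒∣m*n {d} W (∣-trans {d} {P} {M} d∣P (∣ᵤ⇒∣ {P} {M} (ℕ.m∣m*n F)))
    P≢0 : P ≢ 0ℤ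
    P≢0 = *-≢0 (*-≢0 a₀≢0 (*-≢0 a₁≢0 a₂≢0)) (*-≢0 (*-≢0 U+X≢0 U-X≢0) (*-≢0 1+y≢0 1-y≢0))
    W≢0 : W ≢ 0ℤ
    W≢0 = *-≢0 {m = + 2} (λ ()) (*-≢0 U≢0 (*-≢0 X≢0 y≢0))
    *-≢0ℕ : ∀ {m n} → m ≢ 0 → n ≢ 0 → m ℕ.* n ≢ 0
    *-≢0ℕ {m} m≢0 n≢0 eq = [ m≢0 , n≢0 ]′ (ℕ.m*n≡0⇒m≡0∨n≡0 m eq)
    ∣∣≢0 : ∀ {i} → i ≢ 0ℤ → ∣ i ∣ ≢ 0
    ∣∣≢0 i≢0 eq = i≢0 (∣i∣≡0⇒i≡0 eq)
    L≢0 : ∣ W ∣ ℕ.* ∣ W ∣ ℕ.* (∣ P ∣ ℕ.* F) ≢ 0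
    L≢0 = *-≢0ℕ (*-≢0ℕ (∣∣≢0 W≢0) (∣∣≢0 W≢0)) (*-≢0ℕ (∣∣≢0 P≢0) F≢0)
    +L≡ΛW : + (∣ W ∣ ℕ.* ∣ W ∣ ℕ.* (∣ P ∣ ℕ.* F)) ≡ W * M * W
    +L≡ΛW = trans (pos-* (∣ W ∣ ℕ.* ∣ W ∣) (∣ P ∣ ℕ.* F)) (trans (cong (_* M) (abs² W)) (e W M))
      where
      abs² : ∀ x → + (∣ x ∣ ℕ.* ∣ x ∣) ≡ x * x
      abs² (+ n) = pos-* n n
      abs² -[1+ n ] = refl
      e : ∀ w m → w * w * m ≡ w * m * w
      e = solve-∀

  module Family {c₀ c₁ c₂} (base : BaseSolution c₀ c₁ c₂) (mod : Modulus base) where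
    open BaseSolution base
    open Modulus mod public
    open ≡-Reasoning

    α β γ δ W : ℤ
    α = U + X
    β = U - X
    γ = 1ℤ + y
    δ = 1ℤ - y
    W = + 2 * (U * (X * y))

    open Counting.Progression L small∣L public

    -- These are `Λ * W` divided by 2X, 2y, 2 and 2U, the denominators met when solving the linear
    -- system for the `zᵢ`; each quotient is still a multiple of `Λ`.
    k₀ k₁ k₂ k₃ : ℤ
    k₀ = Λ * (U * y)
    k₁ = Λ * (U * X)
    k₂ = Λ * (U * (X * y))
    k₃ = Λ * (X * y)

    shift : ℤ → ℤ → ℤ → ℕ → ℕ → ℤ
    shift k x y m n = 1ℤ + k * (x * ι m + y * ι n)

    infixl 7 _⊙_
    -- `term` turns this operation into multiplication, so products such as r s stay in the
    -- progression.
    _⊙_ : ℕ → ℕ → ℕ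
    i ⊙ k = i ℕ.+ k ℕ.+ L ℕ.* (i ℕ.* k)

    term-⊙ : ∀ i k → term (i ⊙ k) ≡ term i ℕ.* term k
    term-⊙ i k = e L i k
      where
      e : ∀ L i k → ℕ.suc (L ℕ.* (i ℕ.+ k ℕ.+ L ℕ.* (i ℕ.* k))) ≡ ℕ.suc (L ℕ.* i) ℕ.* ℕ.suc (L ℕ.* k)
      e = ℕ.solve-∀

    +term : ∀ n → ι (term n) ≡ 1ℤ + Λ * W * ι n
    +term n = begin
      + (1 ℕ.+ L ℕ.* n)  ≡⟨ pos-+ 1 (L ℕ.* n) ⟩
      1ℤ + + (L ℕ.* n)   ≡⟨ cong (λ x → 1ℤ + x) (trans (pos-* L n) (cong (_* ι n) +L≡ΛW)) ⟩
      1ℤ + Λ * W * ι n   ∎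

    -- The solution of the linear system with r, t, s, v the terms of `i`, `j`, `k`, `l`. The
    -- constant terms are 1 because α - β = 2X, γ - δ = 2y, γ + δ = 2 and α + β = 2U.
    z₀ z₁ z₂ z₃ : ℕ → ℕ → ℕ → ℕ → ℤ
    z₀ i j k l = shift k₀ α (- β) (j ⊙ l) (i ⊙ k)
    z₁ i j k l = shift k₁ γ (- δ) (k ⊙ j) (i ⊙ l)
    z₂ i j k l = shift k₂ δ γ (i ⊙ l) (k ⊙ j)
    z₃ i j k l = shift k₃ β α (i ⊙ k) (j ⊙ l)

    point : ℕ → ℕ → ℕ → ℕ → Tuple
    point i j k l = a₀ * z₀ i j k l ² , a₁ * z₁ i j k l ² , a₂ * z₂ i j k l ² , a₃ * z₃ i j k l ²

    module Relations (i j k l : ℕ) where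
      RS TV RV ST : ℤ
      RS = ι (term (i ⊙ k))
      TV = ι (term (j ⊙ l))
      RV = ι (term (i ⊙ l))
      ST = ι (term (k ⊙ j))

      rel₃ : + 2 * U * z₃ i j k l ≡ β * RS + α * TV
      rel₃ = trans (e U X y Λ (ι (i ⊙ k)) (ι (j ⊙ l))) (sym (cong₂ (λ a b → β * a + α * b) (+term (i ⊙ k)) (+term (j ⊙ l))))
        where
        e : ∀ U X y Λ m n → + 2 * U * (1ℤ + Λ * (X * y) * ((U - X) * m + (U + X) * n))
            ≡ (U - X) * (1ℤ + Λ * (+ 2 * (U * (X * y))) * m) + (U + X) * (1ℤ + Λ * (+ 2 * (U * (X * y))) * n)
        e = solve-∀

      rel₀ : + 2 * X * z₀ i j k l ≡ α * TV + - β * RS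
      rel₀ = trans (e U X y Λ (ι (j ⊙ l)) (ι (i ⊙ k))) (sym (cong₂ (λ a b → α * a + - β * b) (+term (j ⊙ l)) (+term (i ⊙ k))))
        where
        e : ∀ U X y Λ m n → + 2 * X * (1ℤ + Λ * (U * y) * ((U + X) * m + - (U - X) * n))
            ≡ (U + X) * (1ℤ + Λ * (+ 2 * (U * (X * y))) * m) + - (U - X) * (1ℤ + Λ * (+ 2 * (U * (X * y))) * n)
        e = solve-∀

      rel₂ : + 2 * z₂ i j k l ≡ δ * RV + γ * ST
      rel₂ = trans (e U X y Λ (ι (i ⊙ l)) (ι (k ⊙ j))) (sym (cong₂ (λ a b → δ * a + γ * b) (+term (i ⊙ l)) (+term (k ⊙ j))))
        where
        e : ∀ U X y Λ m n → + 2 * (1ℤ + Λ * (U * (X * y)) * ((1ℤ - y) * m + (1ℤ + y) * n))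
            ≡ (1ℤ - y) * (1ℤ + Λ * (+ 2 * (U * (X * y))) * m) + (1ℤ + y) * (1ℤ + Λ * (+ 2 * (U * (X * y))) * n)
        e = solve-∀

      rel₁ : + 2 * y * z₁ i j k l ≡ γ * ST + - δ * RV
      rel₁ = trans (e U X y Λ (ι (k ⊙ j)) (ι (i ⊙ l))) (sym (cong₂ (λ a b → γ * a + - δ * b) (+term (k ⊙ j)) (+term (i ⊙ l))))
        where
        e : ∀ U X y Λ m n → + 2 * y * (1ℤ + Λ * (U * X) * ((1ℤ + y) * m + - (1ℤ - y) * n))
            ≡ (1ℤ + y) * (1ℤ + Λ * (+ 2 * (U * (X * y))) * m) + - (1ℤ - y) * (1ℤ + Λ * (+ 2 * (U * (X * y))) * n)
        e = solve-∀

      exchange : RS * TV ≡ RV * ST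
      exchange = begin
        RS * TV                                          ≡⟨ cong₂ (λ a b → ι a * ι b) (term-⊙ i k) (term-⊙ j l) ⟩
        ι (term i ℕ.* term k) * ι (term j ℕ.* term l)    ≡⟨ pos-* (term i ℕ.* term k) (term j ℕ.* term l) ⟨
        ι (term i ℕ.* term k ℕ.* (term j ℕ.* term l))    ≡⟨ cong +_ (e (term i) (term j) (term k) (term l)) ⟩
        ι (term i ℕ.* term l ℕ.* (term k ℕ.* term j))    ≡⟨ pos-* (term i ℕ.* term l) (term k ℕ.* term j) ⟩
        ι (term i ℕ.* term l) * ι (term k ℕ.* term j)    ≡⟨ cong₂ (λ a b → ι a * ι b) (term-⊙ i l) (term-⊙ k j) ⟨
        RV * ST                                          ∎
        where
        e : ∀ r t s v → r ℕ.* s ℕ.* (t ℕ.* v) ≡ r ℕ.* v ℕ.* (s ℕ.* t)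
        e = ℕ.solve-∀

      equation : c₀ * (a₀ * z₀ i j k l ²) + c₁ * (a₁ * z₁ i j k l ²) + c₂ * (a₂ * z₂ i j k l ²) ≡ a₃ * z₃ i j k l ²
      -- The relations concern 2X z₀, 2y z₁, 2 z₂ and 2U z₃; the factor 4 lets their squares appear.
      equation = *-cancelˡ (+ 4) (λ ()) (begin
        + 4 * (c₀ * (a₀ * Z₀ ²) + c₁ * (a₁ * Z₁ ²) + c₂ * (a₂ * Z₂ ²))
          ≡⟨ e₁ c₀ c₁ c₂ a₀ a₁ a₂ Z₀ Z₁ Z₂ ⟩
        + 4 * ((c₀ * a₀) * Z₀ ² + (c₁ * a₁) * Z₁ ² + (c₂ * a₂) * Z₂ ²)
          ≡⟨ cong (+ 4 *_) (cong₂ _+_ (cong₂ (λ p q → p * Z₀ ² + q * Z₁ ²) eq₀ eq₁) (cong (_* Z₂ ²) eq₂)) ⟩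
        + 4 * (u * X ² * Z₀ ² + - (θ * y ²) * Z₁ ² + θ * Z₂ ²)
          ≡⟨ e₂ u θ X y Z₀ Z₁ Z₂ ⟩
        u * (+ 2 * X * Z₀) ² + - (θ * (+ 2 * y * Z₁) ²) + θ * (+ 2 * Z₂) ²
          ≡⟨ cong₂ _+_ (cong₂ (λ p q → u * p ² + - (θ * q ²)) rel₀ rel₁) (cong (λ p → θ * p ²) rel₂) ⟩
        u * (α * TV + - β * RS) ² + - (θ * (γ * ST + - δ * RV) ²) + θ * (δ * RV + γ * ST) ²
          ≡⟨ quadric-identity u θ α β γ δ RS TV RV ST balance exchange ⟩
        u * (β * RS + α * TV) ²
          ≡⟨ cong (λ p → u * p ²) rel₃ ⟨
        u * (+ 2 * U * Z₃) ²
          ≡⟨ e₃ u U Z₃ ⟩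
        + 4 * (u * U ² * Z₃ ²)
          ≡⟨ cong (λ p → + 4 * (p * Z₃ ²)) eq₃ ⟨
        + 4 * (a₃ * Z₃ ²) ∎)
        where
        Z₀ = z₀ i j k l
        Z₁ = z₁ i j k l
        Z₂ = z₂ i j k l
        Z₃ = z₃ i j k l
        e₁ : ∀ c₀ c₁ c₂ a₀ a₁ a₂ Z₀ Z₁ Z₂ → + 4 * (c₀ * (a₀ * (Z₀ * Z₀)) + c₁ * (a₁ * (Z₁ * Z₁)) + c₂ * (a₂ * (Z₂ * Z₂)))
          ≡ + 4 * ((c₀ * a₀) * (Z₀ * Z₀) + (c₁ * a₁) * (Z₁ * Z₁) + (c₂ * a₂) * (Z₂ * Z₂))
        e₁ = solve-∀
        e₂ : ∀ u θ X y Z₀ Z₁ Z₂ → + 4 * (u * (X * X) * (Z₀ * Z₀) + - (θ * (y * y)) * (Z₁ * Z₁) + θ * (Z₂ * Z₂))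
          ≡ u * ((+ 2 * X * Z₀) * (+ 2 * X * Z₀)) + - (θ * ((+ 2 * y * Z₁) * (+ 2 * y * Z₁))) + θ * ((+ 2 * Z₂) * (+ 2 * Z₂))
        e₂ = solve-∀
        e₃ : ∀ u U Z₃ → u * ((+ 2 * U * Z₃) * (+ 2 * U * Z₃)) ≡ + 4 * (u * (U * U) * (Z₃ * Z₃))
        e₃ = solve-∀

    ∤Λ⇒∤ : ∀ {p x} → x ∣ᶻ Λ → ¬ (+ p ∣ᶻ Λ) → ¬ (+ p ∣ᶻ x)
    ∤Λ⇒∤ {p} {x} x∣Λ p∤Λ p∣x = p∤Λ (∣-trans {+ p} {x} {Λ} p∣x x∣Λ)

    module _ {i j k l} (rt : Coprime (term i) (term j)) (sv : Coprime (term k) (term l)) where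
      open Relations i j k l

      -- If `p` divides `Λ`, the `zᵢ` are 1 modulo `p`, so `p` would divide both `a₀` and `a₂`.
      -- Otherwise `p` divides none of `a₀`, `a₁`, `a₂`, hence divides `z₀`, `z₁`, `z₂` and the
      -- three linear forms of `no-common-prime`.
      no-common-prime-divisor : ∀ {p} → Prime p → + p ∣ᶻ a₀ * z₀ i j k l ² → + p ∣ᶻ a₁ * z₁ i j k l ² → + p ∣ᶻ a₂ * z₂ i j k l ² → ⊥
      no-common-prime-divisor {p} pr p∣x₀ p∣x₁ p∣x₂ = by-cases (+ p ∣? Λ)
        where
        by-cases : _ → ⊥
        by-cases (yes p∣Λ) = ⟂-no-common-prime pr coprime₀₂
              (∣*²⇒∣′ {a = a₀} {z₀ i j k l} pr (1+multiple∤ (U * y) _ pr p∣Λ) p∣x₀)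
              (∣*²⇒∣′ {a = a₂} {z₂ i j k l} pr (1+multiple∤ (U * (X * y)) _ pr p∣Λ) p∣x₂)
        by-cases (no p∤Λ) = no-common-prime α β γ δ pr rt sv (λ p∣2 → p∤Λ (∣-trans p∣2 2∣Λ))
              (∤Λ⇒∤ α∣Λ p∤Λ) (∤Λ⇒∤ β∣Λ p∤Λ) (∤Λ⇒∤ γ∣Λ p∤Λ) (∤Λ⇒∤ δ∣Λ p∤Λ)
              (subst (+ p ∣ᶻ_) (trans rel₀ (cong₂ (λ a b → α * ι a + - β * ι b) (term-⊙ j l) (term-⊙ i k)))
                (∣n⇒∣m*n {+ p} (+ 2 * X) (∣*²⇒∣ {a = a₀} {z₀ i j k l} pr (∤Λ⇒∤ a₀∣Λ p∤Λ) p∣x₀)))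
              (subst (+ p ∣ᶻ_) (trans rel₂ (cong₂ (λ a b → δ * ι a + γ * ι b) (term-⊙ i l) (term-⊙ k j)))
                (∣n⇒∣m*n {+ p} (+ 2) (∣*²⇒∣ {a = a₂} {z₂ i j k l} pr (∤Λ⇒∤ a₂∣Λ p∤Λ) p∣x₂)))
              (subst (+ p ∣ᶻ_) (trans rel₁ (cong₂ (λ a b → γ * ι a + - δ * ι b) (term-⊙ k j) (term-⊙ i l)))
                (∣n⇒∣m*n {+ p} (+ 2 * y) (∣*²⇒∣ {a = a₁} {z₁ i j k l} pr (∤Λ⇒∤ a₁∣Λ p∤Λ) p∣x₁)))

  -- Membership in the box, heights and injectivity of the family.

  gcd₃≡1 : ∀ {x y z} → (∀ {p} → Prime p → p ℕ.∣ x → p ℕ.∣ y → p ℕ.∣ z → ⊥) → gcd (gcd x y) z ≡ 1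
  gcd₃≡1 {x} {y} {z} none = Coprimality.coprime⇒gcd≡1 (coprime-by-primes (λ pr p∣xy p∣z →
    none pr (ℕ.∣-trans p∣xy (gcd[m,n]∣m x y)) (ℕ.∣-trans p∣xy (gcd[m,n]∣n x y)) p∣z))

  ∈-nonzeroUpTo : ∀ {B} x → x ≢ 0ℤ → ∣ x ∣ ≤ B → x ∈ nonzeroUpTo B
  ∈-nonzeroUpTo (+ zero) x≢0 _ = contradiction refl x≢0
  ∈-nonzeroUpTo (+ suc n) _ n<B = ∈-++⁺ˡ (∈-map⁺ (λ k → + suc k) (∈-upTo⁺ n<B))
  ∈-nonzeroUpTo {B} -[1+ n ] _ n<B = ∈-++⁺ʳ (map (λ k → + suc k) (upTo B)) (∈-map⁺ (λ k → -[1+ k ]) (∈-upTo⁺ n<B))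

  ∈-box : ∀ {B x₀ x₁ x₂ x₃} → x₀ ∈ nonzeroUpTo B → x₁ ∈ nonzeroUpTo B → x₂ ∈ nonzeroUpTo B → x₃ ∈ nonzeroUpTo B →
          (x₀ , x₁ , x₂ , x₃) ∈ box B
  ∈-box {B} {x₀} {x₁} {x₂} h₀ h₁ h₂ h₃ =
    ∈-concatMap⁺ (λ a → concatMap (λ b → concatMap (λ c → map (λ d → (a , b , c , d)) R) R) R) (lose h₀
      (∈-concatMap⁺ (λ b → concatMap (λ c → map (λ d → (x₀ , b , c , d)) R) R) (lose h₁
        (∈-concatMap⁺ (λ c → map (λ d → (x₀ , x₁ , c , d)) R) (lose h₂ (∈-map⁺ (λ d → (x₀ , x₁ , x₂ , d)) h₃))))))
    where
    R = nonzeroUpTo B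

  linear-injective : ∀ α β a b a′ b′ → α ≢ 0ℤ → β ≢ 0ℤ → β * a + α * b ≡ β * a′ + α * b′ → α * b + - β * a ≡ α * b′ + - β * a′ →
                     a ≡ a′ × b ≡ b′
  linear-injective α β a b a′ b′ α≢0 β≢0 plus minus =
    *-cancelˡ (+ 2 * β) (*-≢0 {m = + 2} (λ ()) β≢0) (trans (e₁ α β a b) (trans (cong₂ _-_ plus minus) (sym (e₁ α β a′ b′)))) ,
    *-cancelˡ (+ 2 * α) (*-≢0 {m = + 2} (λ ()) α≢0) (trans (e₂ α β a b) (trans (cong₂ _+_ plus minus) (sym (e₂ α β a′ b′))))
    where
    e₁ : ∀ α β a b → + 2 * β * a ≡ (β * a + α * b) - (α * b + - β * a)
    e₁ = solve-∀
    e₂ : ∀ α β a b → + 2 * α * b ≡ (β * a + α * b) + (α * b + - β * a)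
    e₂ = solve-∀

  ∣1+linear∣≤ : ∀ k x y {m n C M} → m ≤ C ℕ.* M → n ≤ C ℕ.* M → 1 ≤ M →
    ∣ 1ℤ + k * (x * + m + y * + n) ∣ ≤ (1 ℕ.+ ∣ k ∣ ℕ.* (∣ x ∣ ℕ.+ ∣ y ∣) ℕ.* C) ℕ.* M
  ∣1+linear∣≤ k x y {m} {n} {C} {M} m≤ n≤ 1≤M = begin
    ∣ 1ℤ + k * (x * + m + y * + n) ∣                               ≤⟨ ∣i+j∣≤∣i∣+∣j∣ 1ℤ (k * (x * + m + y * + n)) ⟩
    1 ℕ.+ ∣ k * (x * + m + y * + n) ∣                              ≡⟨ cong (1 ℕ.+_) (abs-* k (x * + m + y * + n)) ⟩
    1 ℕ.+ ∣ k ∣ ℕ.* ∣ x * + m + y * + n ∣                          ≤⟨ ℕ.+-monoʳ-≤ 1 (ℕ.*-monoʳ-≤ (∣ k ∣) (∣i+j∣≤∣i∣+∣j∣ (x * + m) (y * + n))) ⟩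
    1 ℕ.+ ∣ k ∣ ℕ.* (∣ x * + m ∣ ℕ.+ ∣ y * + n ∣)                  ≡⟨ cong₂ (λ a b → 1 ℕ.+ ∣ k ∣ ℕ.* (a ℕ.+ b)) (abs-* x (+ m)) (abs-* y (+ n)) ⟩
    1 ℕ.+ ∣ k ∣ ℕ.* (∣ x ∣ ℕ.* m ℕ.+ ∣ y ∣ ℕ.* n)                  ≤⟨ ℕ.+-mono-≤ 1≤M (ℕ.*-monoʳ-≤ (∣ k ∣) (ℕ.+-mono-≤ (ℕ.*-monoʳ-≤ (∣ x ∣) m≤) (ℕ.*-monoʳ-≤ (∣ y ∣) n≤))) ⟩
    M ℕ.+ ∣ k ∣ ℕ.* (∣ x ∣ ℕ.* (C ℕ.* M) ℕ.+ ∣ y ∣ ℕ.* (C ℕ.* M))  ≡⟨ e (∣ k ∣) (∣ x ∣) (∣ y ∣) C M ⟩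
    (1 ℕ.+ ∣ k ∣ ℕ.* (∣ x ∣ ℕ.+ ∣ y ∣) ℕ.* C) ℕ.* M                ∎
    where
    open ℕ.≤-Reasoning
    e : ∀ k x y C M → M ℕ.+ k ℕ.* (x ℕ.* (C ℕ.* M) ℕ.+ y ℕ.* (C ℕ.* M)) ≡ (1 ℕ.+ k ℕ.* (x ℕ.+ y) ℕ.* C) ℕ.* M
    e = ℕ.solve-∀

  ∣*²∣≤ : ∀ {a z A K M} → ∣ a ∣ ≤ A → ∣ z ∣ ≤ K ℕ.* M → ∣ a * z ² ∣ ≤ A ℕ.* (K ℕ.* K) ℕ.* (M ℕ.* M)
  ∣*²∣≤ {a} {z} {A} {K} {M} a≤ z≤ = begin
    ∣ a * z ² ∣                          ≡⟨ trans (abs-* a (z ²)) (cong (∣ a ∣ ℕ.*_) (abs-* z z)) ⟩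
    ∣ a ∣ ℕ.* (∣ z ∣ ℕ.* ∣ z ∣)          ≤⟨ ℕ.*-mono-≤ a≤ (ℕ.*-mono-≤ z≤ z≤) ⟩
    A ℕ.* (K ℕ.* M ℕ.* (K ℕ.* M))        ≡⟨ e A K M ⟩
    A ℕ.* (K ℕ.* K) ℕ.* (M ℕ.* M)        ∎
    where
    open ℕ.≤-Reasoning
    e : ∀ A K M → A ℕ.* (K ℕ.* M ℕ.* (K ℕ.* M)) ≡ A ℕ.* (K ℕ.* K) ℕ.* (M ℕ.* M)
    e = ℕ.solve-∀

  module Points {c₀ c₁ c₂} (base : BaseSolution c₀ c₁ c₂) (mod : Modulus base) where
    open BaseSolution base
    open Family base mod
    open Counting using (injection⇒length≤)

    point-cond : ∀ {i j k l} → Coprime (term i) (term j) → Coprime (term k) (term l) → Cond c₀ c₁ c₂ (point i j k l)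
    point-cond {i} {j} {k} {l} rt sv =
      gcd₃≡1 (λ pr h₀ h₁ h₂ → no-common-prime-divisor rt sv pr (∣ᵤ⇒∣ h₀) (∣ᵤ⇒∣ h₁) (∣ᵤ⇒∣ h₂)) ,
      Squareful-*² {a₀} (z₀ i j k l) squareful₀ , Squareful-*² {a₁} (z₁ i j k l) squareful₁ ,
      Squareful-*² {a₂} (z₂ i j k l) squareful₂ , Squareful-*² {a₃} (z₃ i j k l) squareful₃ ,
      Relations.equation i j k l

    *²≢0 : ∀ {a} c x → a ≢ 0ℤ → a * (1ℤ + Λ * c * x) ² ≢ 0ℤ
    *²≢0 c x a≢0 = *-≢0 a≢0 (*-≢0 (1+multiple≢0 c x 3∣Λ) (1+multiple≢0 c x 3∣Λ))

    -- The squares determine the `zᵢ`, which are 1 modulo 3; the linear system then gives r s, t v,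
    -- r v and s t; each factor is the gcd of the two products containing it.
    point-injective : ∀ {i j k l i′ j′ k′ l′} →
      Coprime (term i) (term j) → Coprime (term k) (term l) → Coprime (term i′) (term j′) → Coprime (term k′) (term l′) →
      point i j k l ≡ point i′ j′ k′ l′ → ((i , j) , (k , l)) ≡ ((i′ , j′) , (k′ , l′))
    point-injective {i} {j} {k} {l} {i′} {j′} {k′} {l′} rt sv rt′ sv′ eq = cong₂ _,_ (cong₂ _,_ i≡ j≡) (cong₂ _,_ k≡ l≡)
      where
      module R = Relations i j k l
      module R′ = Relations i′ j′ k′ l′
      same : ∀ {a} c x x′ → a ≢ 0ℤ → a * (1ℤ + Λ * c * x) ² ≡ a * (1ℤ + Λ * c * x′) ² → 1ℤ + Λ * c * x ≡ 1ℤ + Λ * c * x′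
      same c x x′ a≢0 e = 1+multiple-square-injective c x x′ 3∣Λ (*²-injective {z = 1ℤ + Λ * c * x} {1ℤ + Λ * c * x′} a≢0 e)
      same₀ : z₀ i j k l ≡ z₀ i′ j′ k′ l′
      same₀ = same (U * y) _ _ a₀≢0 (cong proj₁ eq)
      same₁ : z₁ i j k l ≡ z₁ i′ j′ k′ l′
      same₁ = same (U * X) _ _ a₁≢0 (cong (λ t → proj₁ (proj₂ t)) eq)
      same₂ : z₂ i j k l ≡ z₂ i′ j′ k′ l′
      same₂ = same (U * (X * y)) _ _ a₂≢0 (cong (λ t → proj₁ (proj₂ (proj₂ t))) eq)
      same₃ : z₃ i j k l ≡ z₃ i′ j′ k′ l′
      same₃ = same (X * y) _ _ a₃≢0 (cong (λ t → proj₂ (proj₂ (proj₂ t))) eq)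
      RS,TV : R.RS ≡ R′.RS × R.TV ≡ R′.TV
      RS,TV = linear-injective α β R.RS R.TV R′.RS R′.TV U+X≢0 U-X≢0
        (trans (sym R.rel₃) (trans (cong (+ 2 * U *_) same₃) R′.rel₃))
        (trans (sym R.rel₀) (trans (cong (+ 2 * X *_) same₀) R′.rel₀))
      RV,ST : R.RV ≡ R′.RV × R.ST ≡ R′.ST
      RV,ST = linear-injective γ δ R.RV R.ST R′.RV R′.ST 1+y≢0 1-y≢0
        (trans (sym R.rel₂) (trans (cong (+ 2 *_) same₂) R′.rel₂))
        (trans (sym R.rel₁) (trans (cong (+ 2 * y *_) same₁) R′.rel₁))
      product≡ : ∀ a b a′ b′ → + term (a ⊙ b) ≡ + term (a′ ⊙ b′) → term a ℕ.* term b ≡ term a′ ℕ.* term b′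
      product≡ a b a′ b′ e = trans (sym (term-⊙ a b)) (trans (+-injective e) (term-⊙ a′ b′))
      swap : ∀ a b a′ b′ → term a ℕ.* term b ≡ term a′ ℕ.* term b′ → term b ℕ.* term a ≡ term b′ ℕ.* term a′
      swap a b a′ b′ e = trans (ℕ.*-comm (term b) (term a)) (trans e (ℕ.*-comm (term a′) (term b′)))
      rs = product≡ i k i′ k′ (proj₁ RS,TV)
      tv = product≡ j l j′ l′ (proj₂ RS,TV)
      rv = product≡ i l i′ l′ (proj₁ RV,ST)
      st = product≡ k j k′ j′ (proj₂ RV,ST)
      term-injective : ∀ {a a′} → term a ≡ term a′ → a ≡ a′
      term-injective {a} {a′} e = ℕ.*-cancelˡ-≡ a a′ L {{ℕ.>-nonZero L>0}} (ℕ.suc-injective e)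
      i≡ : i ≡ i′
      i≡ = term-injective (factor-recovery sv sv′ rs rv)
      j≡ : j ≡ j′
      j≡ = term-injective (factor-recovery sv sv′ (swap k j k′ j′ st) tv)
      k≡ : k ≡ k′
      k≡ = term-injective (factor-recovery rt rt′ (swap i k i′ k′ rs) st)
      l≡ : l ≡ l′
      l≡ = term-injective (factor-recovery rt rt′ (swap i l i′ l′ rv) (swap j l j′ l′ tv))

    -- `C` bounds `i ⊙ k` against `m * n`, `K` the `zᵢ` against `2 ^ E`, and `A` the `aᵢ`. All
    -- coordinates are then at most κ 4^E, and `suc` makes `κ` positive.
    C K A κ : ℕ
    C = 6 ℕ.+ 9 ℕ.* L
    K = 1 ℕ.+ (∣ k₀ ∣ ℕ.+ ∣ k₁ ∣ ℕ.+ ∣ k₂ ∣ ℕ.+ ∣ k₃ ∣) ℕ.* (∣ α ∣ ℕ.+ ∣ β ∣ ℕ.+ ∣ γ ∣ ℕ.+ ∣ δ ∣) ℕ.* C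
    A = ∣ a₀ ∣ ℕ.+ ∣ a₁ ∣ ℕ.+ ∣ a₂ ∣ ℕ.+ ∣ a₃ ∣
    κ = suc (A ℕ.* (K ℕ.* K))

    ⊙≤ : ∀ {i k m n} → 0 < m → 0 < n → i ≤ 3 ℕ.* m → k ≤ 3 ℕ.* n → i ⊙ k ≤ C ℕ.* (m ℕ.* n)
    ⊙≤ {i} {k} {m} {n} m>0 n>0 i≤ k≤ = begin
      i ℕ.+ k ℕ.+ L ℕ.* (i ℕ.* k)
        ≤⟨ ℕ.+-mono-≤ (ℕ.+-mono-≤ i≤ k≤) (ℕ.*-monoʳ-≤ L (ℕ.*-mono-≤ i≤ k≤)) ⟩
      3 ℕ.* m ℕ.+ 3 ℕ.* n ℕ.+ L ℕ.* (3 ℕ.* m ℕ.* (3 ℕ.* n))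
        ≤⟨ ℕ.+-monoˡ-≤ _ (ℕ.+-mono-≤ (ℕ.*-monoʳ-≤ 3 (ℕ.m≤m*n m n {{ℕ.>-nonZero n>0}})) (ℕ.*-monoʳ-≤ 3 (ℕ.m≤n*m n m {{ℕ.>-nonZero m>0}}))) ⟩
      3 ℕ.* (m ℕ.* n) ℕ.+ 3 ℕ.* (m ℕ.* n) ℕ.+ L ℕ.* (3 ℕ.* m ℕ.* (3 ℕ.* n))
        ≡⟨ e L m n ⟩
      C ℕ.* (m ℕ.* n) ∎
      where
      open ℕ.≤-Reasoning
      e : ∀ L m n → 3 ℕ.* (m ℕ.* n) ℕ.+ 3 ℕ.* (m ℕ.* n) ℕ.+ L ℕ.* (3 ℕ.* m ℕ.* (3 ℕ.* n)) ≡ (6 ℕ.+ 9 ℕ.* L) ℕ.* (m ℕ.* n)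
      e = ℕ.solve-∀

    shift≤ : ∀ k x y {m n M} → m ≤ C ℕ.* M → n ≤ C ℕ.* M → 1 ≤ M →
             ∣ k ∣ ≤ ∣ k₀ ∣ ℕ.+ ∣ k₁ ∣ ℕ.+ ∣ k₂ ∣ ℕ.+ ∣ k₃ ∣ → ∣ x ∣ ℕ.+ ∣ y ∣ ≤ ∣ α ∣ ℕ.+ ∣ β ∣ ℕ.+ ∣ γ ∣ ℕ.+ ∣ δ ∣ →
             ∣ shift k x y m n ∣ ≤ K ℕ.* M
    shift≤ k x y {M = M} m≤ n≤ 1≤M k≤ xy≤ =
      ℕ.≤-trans (∣1+linear∣≤ k x y m≤ n≤ 1≤M) (ℕ.*-monoˡ-≤ M (ℕ.+-monoʳ-≤ 1 (ℕ.*-monoˡ-≤ C (ℕ.*-mono-≤ k≤ xy≤))))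

    first-of-four : ∀ a b c d → a ≤ a ℕ.+ b ℕ.+ c ℕ.+ d
    first-of-four a b c d = ℕ.≤-trans (ℕ.m≤m+n a b) (ℕ.≤-trans (ℕ.m≤m+n (a ℕ.+ b) c) (ℕ.m≤m+n _ d))
    second-of-four : ∀ a b c d → b ≤ a ℕ.+ b ℕ.+ c ℕ.+ d
    second-of-four a b c d = ℕ.≤-trans (ℕ.m≤n+m b a) (ℕ.≤-trans (ℕ.m≤m+n (a ℕ.+ b) c) (ℕ.m≤m+n _ d))
    third-of-four : ∀ a b c d → c ≤ a ℕ.+ b ℕ.+ c ℕ.+ d
    third-of-four a b c d = ℕ.≤-trans (ℕ.m≤n+m c (a ℕ.+ b)) (ℕ.m≤m+n _ d)
    last-of-four : ∀ a b c d → d ≤ a ℕ.+ b ℕ.+ c ℕ.+ d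
    last-of-four a b c d = ℕ.m≤n+m d (a ℕ.+ b ℕ.+ c)
    front-pair : ∀ a b c d → a ℕ.+ b ≤ a ℕ.+ b ℕ.+ c ℕ.+ d
    front-pair a b c d = ℕ.≤-trans (ℕ.m≤m+n (a ℕ.+ b) c) (ℕ.m≤m+n _ d)
    back-pair : ∀ a b c d → c ℕ.+ d ≤ a ℕ.+ b ℕ.+ c ℕ.+ d
    back-pair a b c d = ℕ.+-monoˡ-≤ d (ℕ.m≤n+m c (a ℕ.+ b))

    point∈box : ∀ {B E i j k l} → κ ℕ.* (2 ℕ.^ E ℕ.* 2 ℕ.^ E) ≤ B → Admissible E i j k l → point i j k l ∈ box B
    point∈box {B} {E} {i} {j} {k} {l} κ≤B adm = ∈-box {B}
      (entry (U * y) _ a₀≢0 (first-of-four (∣ a₀ ∣) (∣ a₁ ∣) (∣ a₂ ∣) (∣ a₃ ∣))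
        (shift≤ k₀ α (- β) jl ik 1≤M (first-of-four (∣ k₀ ∣) (∣ k₁ ∣) (∣ k₂ ∣) (∣ k₃ ∣)) αβ))
      (entry (U * X) _ a₁≢0 (second-of-four (∣ a₀ ∣) (∣ a₁ ∣) (∣ a₂ ∣) (∣ a₃ ∣))
        (shift≤ k₁ γ (- δ) kj il 1≤M (second-of-four (∣ k₀ ∣) (∣ k₁ ∣) (∣ k₂ ∣) (∣ k₃ ∣)) γδ))
      (entry (U * (X * y)) _ a₂≢0 (third-of-four (∣ a₀ ∣) (∣ a₁ ∣) (∣ a₂ ∣) (∣ a₃ ∣))
        (shift≤ k₂ δ γ il kj 1≤M (third-of-four (∣ k₀ ∣) (∣ k₁ ∣) (∣ k₂ ∣) (∣ k₃ ∣)) δγ))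
      (entry (X * y) _ a₃≢0 (last-of-four (∣ a₀ ∣) (∣ a₁ ∣) (∣ a₂ ∣) (∣ a₃ ∣))
        (shift≤ k₃ β α ik jl 1≤M (last-of-four (∣ k₀ ∣) (∣ k₁ ∣) (∣ k₂ ∣) (∣ k₃ ∣)) βα))
      where
      open Admissible adm
      bound : ∀ {a b} → a ≤ 3 ℕ.* m → b ≤ 3 ℕ.* n → a ⊙ b ≤ C ℕ.* 2 ℕ.^ E
      bound a≤ b≤ = subst (λ M → _ ≤ C ℕ.* M) m*n≡2^E (⊙≤ m>0 n>0 a≤ b≤)
      ik = bound i≤3m k≤3n
      jl = bound j≤3m l≤3n
      il = bound i≤3m l≤3n
      kj : k ⊙ j ≤ C ℕ.* 2 ℕ.^ E
      -- `bound` expects an index of the first pair on the left; `⊙` is commutative.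
      kj = subst (_≤ C ℕ.* 2 ℕ.^ E) (cong₂ (λ a b → a ℕ.+ L ℕ.* b) (ℕ.+-comm j k) (ℕ.*-comm j k)) (bound j≤3m k≤3n)
      1≤M : 1 ≤ 2 ℕ.^ E
      1≤M = ℕ.m^n>0 2 E
      αβ : ∣ α ∣ ℕ.+ ∣ - β ∣ ≤ ∣ α ∣ ℕ.+ ∣ β ∣ ℕ.+ ∣ γ ∣ ℕ.+ ∣ δ ∣
      αβ = subst (λ b → ∣ α ∣ ℕ.+ b ≤ ∣ α ∣ ℕ.+ ∣ β ∣ ℕ.+ ∣ γ ∣ ℕ.+ ∣ δ ∣) (sym (∣-i∣≡∣i∣ β)) (front-pair (∣ α ∣) (∣ β ∣) (∣ γ ∣) (∣ δ ∣))
      βα : ∣ β ∣ ℕ.+ ∣ α ∣ ≤ ∣ α ∣ ℕ.+ ∣ β ∣ ℕ.+ ∣ γ ∣ ℕ.+ ∣ δ ∣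
      βα = ℕ.≤-trans (ℕ.≤-reflexive (ℕ.+-comm (∣ β ∣) (∣ α ∣))) (front-pair (∣ α ∣) (∣ β ∣) (∣ γ ∣) (∣ δ ∣))
      γδ : ∣ γ ∣ ℕ.+ ∣ - δ ∣ ≤ ∣ α ∣ ℕ.+ ∣ β ∣ ℕ.+ ∣ γ ∣ ℕ.+ ∣ δ ∣
      γδ = subst (λ b → ∣ γ ∣ ℕ.+ b ≤ ∣ α ∣ ℕ.+ ∣ β ∣ ℕ.+ ∣ γ ∣ ℕ.+ ∣ δ ∣) (sym (∣-i∣≡∣i∣ δ)) (back-pair (∣ α ∣) (∣ β ∣) (∣ γ ∣) (∣ δ ∣))
      δγ : ∣ δ ∣ ℕ.+ ∣ γ ∣ ≤ ∣ α ∣ ℕ.+ ∣ β ∣ ℕ.+ ∣ γ ∣ ℕ.+ ∣ δ ∣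
      δγ = ℕ.≤-trans (ℕ.≤-reflexive (ℕ.+-comm (∣ δ ∣) (∣ γ ∣))) (back-pair (∣ α ∣) (∣ β ∣) (∣ γ ∣) (∣ δ ∣))
      entry : ∀ {a} c x → a ≢ 0ℤ → ∣ a ∣ ≤ A → ∣ 1ℤ + Λ * c * x ∣ ≤ K ℕ.* 2 ℕ.^ E → a * (1ℤ + Λ * c * x) ² ∈ nonzeroUpTo B
      entry {a} c x a≢0 a≤ z≤ = ∈-nonzeroUpTo (a * (1ℤ + Λ * c * x) ²) (*²≢0 c x a≢0)
        (ℕ.≤-trans (∣*²∣≤ {a} {1ℤ + Λ * c * x} {A} {K} {2 ℕ.^ E} a≤ z≤)
          (ℕ.≤-trans (ℕ.*-monoˡ-≤ (2 ℕ.^ E ℕ.* 2 ℕ.^ E) (ℕ.n≤1+n (A ℕ.* (K ℕ.* K)))) κ≤B))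

    solutions-many : ∀ B E → κ ℕ.* (2 ℕ.^ E ℕ.* 2 ℕ.^ E) ≤ B →
      suc E ℕ.* (2 ℕ.^ E ℕ.* 2 ℕ.^ E) ≤ 4 ℕ.* length (filter (cond? c₀ c₁ c₂) (box B))
    solutions-many B E κ≤B = ℕ.≤-trans (quadruples-many E) (ℕ.*-monoʳ-≤ 4
      (injection⇒length≤ (λ ((i , j) , (k , l)) → point i j k l) _ (quadruples-unique E) into
        (λ q∈ q′∈ → inj (∈-quadruples⁻ E q∈) (∈-quadruples⁻ E q′∈))))
      where
      into : ∀ {q} → q ∈ quadruples E → _ ∈ filter (cond? c₀ c₁ c₂) (box B)
      into {(i , j) , (k , l)} q∈ = ∈-filter⁺ (cond? c₀ c₁ c₂) (point∈box {B} {E} κ≤B adm) (point-cond (coprime-ij adm) (coprime-kl adm))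
        where
        open Admissible
        adm = ∈-quadruples⁻ E q∈
      inj : ∀ {i j k l i′ j′ k′ l′} → Admissible E i j k l → Admissible E i′ j′ k′ l′ →
            point i j k l ≡ point i′ j′ k′ l′ → ((i , j) , (k , l)) ≡ ((i′ , j′) , (k′ , l′))
      inj adm adm′ = point-injective (coprime-ij adm) (coprime-kl adm) (coprime-ij adm′) (coprime-kl adm′)
        where open Admissible

  -- Existence of a base solution

  SquareFree : ℕ → Set
  SquareFree n = ∀ {p} → Prime p → ¬ p ℕ.* p ℕ.∣ n

  prime∣prime⇒≡ : ∀ {p q} → Prime p → Prime q → p ℕ.∣ q → p ≡ q
  prime∣prime⇒≡ pp pq p∣q = [ (λ p≡1 → contradiction (subst Prime p≡1 pp) ¬prime[1]) , (λ p≡q → p≡q) ]′ (prime⇒irreducible pq p∣q)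

  squareful-or-exact-prime : ∀ n → 0 < n → Squarefulℕ n ⊎ ∃ λ p → Prime p × p ℕ.∣ n × ¬ p ℕ.^ 2 ℕ.∣ n
  squareful-or-exact-prime n n>0 with any? (λ (i : Fin (suc n)) → prime? (toℕ i) ×-dec ((toℕ i ℕ.∣? n) ×-dec ¬? (toℕ i ℕ.^ 2 ℕ.∣? n)))
  ... | yes (i , exact) = inj₂ (toℕ i , exact)
  ... | no none = inj₁ (λ p pr p∣n → decidable-stable (p ℕ.^ 2 ℕ.∣? n) (λ p²∤n →
    let p< = s≤s (ℕ.∣⇒≤ {{ℕ.>-nonZero n>0}} p∣n) in
    none (fromℕ< p< , subst (λ p → Prime p × p ℕ.∣ n × ¬ p ℕ.^ 2 ℕ.∣ n) (sym (toℕ-fromℕ< p<)) (pr , p∣n , p²∤n))))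

  record SquarefreeSplit (n : ℕ) : Set where
    field
      {a b} : ℕ
      n≡a*b : n ≡ a ℕ.* b
      squarefree : SquareFree a
      squareful : Squarefulℕ b
      coprime : Coprime a b

  cofactor>0 : ∀ {n k p} → 0 < n → n ≡ k ℕ.* p → 0 < k
  cofactor>0 {k = zero} n>0 refl = n>0
  cofactor>0 {k = suc k} _ _ = s≤s z≤n

  cofactor< : ∀ {n k p} → 0 < n → n ≡ k ℕ.* p → p ≢ 1 → k < n
  cofactor< {n} {k} {0} n>0 eq p≢1 = contradiction (trans eq (ℕ.*-zeroʳ k)) (ℕ.m<n⇒n≢0 n>0)
  cofactor< {n} {k} {1} n>0 eq p≢1 = contradiction refl p≢1
  cofactor< {n} {k} {p@(suc (suc _))} n>0 refl p≢1 = ℕ.m<m*n k p {{ℕ.>-nonZero (cofactor>0 {p = p} n>0 refl)}} (s≤s (s≤s z≤n))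

  -- Strips off one prime `p` dividing `n` exactly once and recurses. The cofactor is prime to `p`,
  -- so putting `p` back into `a` keeps `a` squarefree and coprime to `b`.
  squarefree-split : ∀ n → 0 < n → SquarefreeSplit n
  squarefree-split = <-rec (λ n → 0 < n → SquarefreeSplit n) go
    where
    go : ∀ n → (∀ {k} → k < n → 0 < k → SquarefreeSplit k) → 0 < n → SquarefreeSplit n
    go n rec n>0 with squareful-or-exact-prime n n>0
    ... | inj₁ sq = record
      { n≡a*b = sym (ℕ.*-identityˡ n)
      ; squarefree = λ {p} pr p²∣1 → prime∤1 pr (ℕ.∣-trans (ℕ.m∣m*n p) p²∣1)
      ; squareful = sq
      ; coprime = Coprimality.1-coprimeTo n }
    ... | inj₂ (p , pr , ℕ.divides k n≡kp , p²∤n)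
      with rec (cofactor< n>0 n≡kp (λ p≡1 → ¬prime[1] (subst Prime p≡1 pr))) (cofactor>0 n>0 n≡kp)
    ... | record { a = a ; b = b ; n≡a*b = k≡ab ; squarefree = sf ; squareful = sq ; coprime = co } = record
      { n≡a*b = trans n≡kp (trans (cong (ℕ._* p) k≡ab) (e a b p))
      ; squarefree = sf′
      ; squareful = sq
      ; coprime = coprime-by-primes (λ {t} prt t∣ap t∣b →
          [ (λ t∣a → ¬prime[1] (subst Prime (co (t∣a , t∣b)) prt))
          , (λ t∣p → p∤k (subst (p ℕ.∣_) (sym k≡ab) (ℕ.∣n⇒∣m*n a (subst (ℕ._∣ b) (prime∣prime⇒≡ prt pr t∣p) t∣b)))) ]′
          (euclidsLemma a p prt t∣ap)) }
      where
      e : ∀ a b p → a ℕ.* b ℕ.* p ≡ a ℕ.* p ℕ.* b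
      e = ℕ.solve-∀
      p∤k : ¬ p ℕ.∣ k
      p∤k p∣k = p²∤n (subst₂ ℕ._∣_ (cong (p ℕ.*_) (sym (ℕ.*-identityʳ p))) (sym n≡kp) (ℕ.*-pres-∣ p∣k ℕ.∣-refl))
      sf′ : SquareFree (a ℕ.* p)
      sf′ {t} prt t²∣ap with t ℕ.≟ p
      ... | yes refl = p∤k (subst (p ℕ.∣_) (sym k≡ab) (ℕ.∣m⇒∣m*n b (ℕ.*-cancelʳ-∣ {p} {a} p {{prime⇒nonZero pr}} t²∣ap)))
      -- The square of `t` is coprime to `p`, so it divides `a` already.
      ... | no t≢p = sf prt (Coprimality.coprime-divisor {o = a} t²⊥p (subst (t ℕ.* t ℕ.∣_) (ℕ.*-comm a p) t²∣ap))
        where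
        t²⊥p : Coprime (t ℕ.* t) p
        t²⊥p = coprime-by-primes (λ {r} prr r∣t² r∣p →
          let r∣t = [ (λ h → h) , (λ h → h) ]′ (euclidsLemma t t prr r∣t²) in
          t≢p (trans (sym (prime∣prime⇒≡ prr prt r∣t)) (prime∣prime⇒≡ prr pr r∣p)))

  record RadicalSplit (n c : ℕ) : Set where
    field
      {d f} : ℕ
      n≡d*f : n ≡ d ℕ.* f
      supported : ∀ {p} → Prime p → p ℕ.∣ d → p ℕ.∣ c
      coprime : Coprime f c

  -- Divides by `gcd n c` until this gcd is 1; every prime removed divides `c`.
  radical-split : ∀ c n → 0 < n → RadicalSplit n c
  radical-split c = <-rec (λ n → 0 < n → RadicalSplit n c) go
    where
    go : ∀ n → (∀ {k} → k < n → 0 < k → RadicalSplit k c) → 0 < n → RadicalSplit n c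
    go n rec n>0 with gcd n c ℕ.≟ 1
    ... | yes g≡1 = record
      { n≡d*f = sym (ℕ.*-identityˡ n)
      ; supported = λ pr p∣1 → contradiction p∣1 (prime∤1 pr)
      ; coprime = Coprimality.gcd≡1⇒coprime g≡1 }
    ... | no g≢1 with gcd[m,n]∣m n c
    ... | ℕ.divides k n≡kg with rec (cofactor< {k = k} {gcd n c} n>0 n≡kg g≢1) (cofactor>0 {p = gcd n c} n>0 n≡kg)
    ... | record { d = d ; f = f ; n≡d*f = k≡df ; supported = sup ; coprime = co } = record
      { n≡d*f = trans n≡kg (trans (cong (ℕ._* gcd n c) k≡df) (e d f (gcd n c)))
      ; supported = λ pr p∣dg → [ sup pr , (λ p∣g → ℕ.∣-trans p∣g (gcd[m,n]∣n n c)) ]′ (euclidsLemma d (gcd n c) pr p∣dg)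
      ; coprime = co }
      where
      e : ∀ d f g → d ℕ.* f ℕ.* g ≡ d ℕ.* g ℕ.* f
      e = ℕ.solve-∀

  -- A prime dividing q / gcd(q, c) divides `q` and `c`, hence the gcd, so its square would divide
  -- `q`.
  squarefree-divides : ∀ {q c} → SquareFree q → (∀ {p} → Prime p → p ℕ.∣ q → p ℕ.∣ c) → q ℕ.∣ c
  squarefree-divides {q} {c} sf sup with gcd[m,n]∣m q c
  ... | ℕ.divides k q≡kg with k ℕ.≟ 1
  ... | yes refl = subst (ℕ._∣ c) (trans (sym (ℕ.*-identityˡ _)) (sym q≡kg)) (gcd[m,n]∣n q c)
  ... | no k≢1 with prime-divisor k k≢1
  ... | p , pr , p∣k = contradiction (subst (p ℕ.* p ℕ.∣_) (sym q≡kg) (ℕ.*-pres-∣ p∣k (gcd-greatest p∣q (sup pr p∣q)))) (sf pr)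
    where
    p∣q : p ℕ.∣ q
    p∣q = subst (p ℕ.∣_) (sym q≡kg) (ℕ.∣m⇒∣m*n (gcd q c) p∣k)

  -- Of the primes dividing n₀ exactly once, q collects those dividing n₂ exactly once, and p the others.
  record JointSplit (n₀ n₂ : ℕ) : Set where
    field
      {p q m C f} : ℕ
      n₀≡ : n₀ ≡ p ℕ.* q ℕ.* m
      n₂≡ : n₂ ≡ q ℕ.* C ℕ.* f
      squareful-m : Squarefulℕ m
      squareful-C : Squarefulℕ C
      coprime-pq : Coprime p q
      coprime-m : Coprime m (p ℕ.* q)
      coprime-f : Coprime f (p ℕ.* q)
      supported-C : ∀ {t} → Prime t → t ℕ.∣ C → t ℕ.∣ p ℕ.* q

  -- Let `c` be the squarefree factor of `n₀`. The part of `n₂` supported on `c` splits into a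
  -- squarefree `q` and a squareful `C`; then `q` divides `c`, with quotient `p`.
  joint-split : ∀ n₀ n₂ → 0 < n₀ → 0 < n₂ → JointSplit n₀ n₂
  joint-split n₀ n₂ n₀>0 n₂>0 with squarefree-split n₀ n₀>0
  ... | record { a = c ; b = m ; n≡a*b = n₀≡cm ; squarefree = sf-c ; squareful = sq-m ; coprime = c⊥m }
    with radical-split c n₂ n₂>0
  ... | record { d = d ; f = f ; n≡d*f = n₂≡df ; supported = sup ; coprime = f⊥c }
    with squarefree-split d (cofactor>0 n₂>0 n₂≡df)
  ... | record { a = q ; b = C ; n≡a*b = d≡qC ; squarefree = sf-q ; squareful = sq-C }
    with squarefree-divides sf-q (λ {t} pr t∣q → sup pr (subst (t ℕ.∣_) (sym d≡qC) (ℕ.∣m⇒∣m*n C t∣q)))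
  ... | ℕ.divides p refl = record
    { p = p ; q = q ; m = m ; C = C ; f = f
    ; n₀≡ = n₀≡cm
    ; n₂≡ = trans n₂≡df (cong (ℕ._* f) d≡qC)
    ; squareful-m = sq-m
    ; squareful-C = sq-C
    ; coprime-pq = coprime-by-primes (λ pr t∣p t∣q → sf-c pr (ℕ.*-pres-∣ t∣p t∣q))
    ; coprime-m = Coprimality.sym c⊥m
    ; coprime-f = f⊥c
    ; supported-C = λ {t} pr t∣C → sup pr (subst (t ℕ.∣_) (sym d≡qC) (ℕ.∣n⇒∣m*n q t∣C)) }

  -- Bézout coprimality and the congruences for `B`.

  ⟂-sym : ∀ {a b} → a ⟂ b → b ⟂ a
  ⟂-sym {a} {b} (s , t , eq) = t , s , trans (+-comm (t * b) (s * a)) eq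

  ⟂-* : ∀ {a b c} → a ⟂ b → a ⟂ c → a ⟂ b * c
  ⟂-* {a} {b} {c} (s , t , eq) (s′ , t′ , eq′) =
    s * (s′ * a + t′ * c) + t * b * s′ , t * t′ , trans (e a b c s t s′ t′) (cong₂ _*_ eq eq′)
    where
    e : ∀ a b c s t s′ t′ → (s * (s′ * a + t′ * c) + t * b * s′) * a + t * t′ * (b * c) ≡ (s * a + t * b) * (s′ * a + t′ * c)
    e = solve-∀

  ⟂-∣ : ∀ {a b d} → a ⟂ b → d ∣ᶻ b → a ⟂ d
  ⟂-∣ {a} {b} {d} (s , t , eq) (divides k b≡kd) = s , t * k , trans (cong (λ x → s * a + x) (trans (*-assoc t k d) (cong (t *_) (sym b≡kd)))) eq

  coprime⇒⟂ : ∀ {m n} → Coprime m n → + m ⟂ + n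
  coprime⇒⟂ {m} {n} c = bézout (Coprimality.coprime-Bézout c)
    where
    lift : ∀ x y a b → 1 ℕ.+ y ℕ.* b ≡ x ℕ.* a → 1ℤ + + y * + b ≡ + x * + a
    lift x y a b eq = trans (cong (λ z → 1ℤ + z) (sym (pos-* y b))) (trans (cong +_ eq) (pos-* x a))
    rearrange : ∀ s t a b → 1ℤ + t * b ≡ s * a → s * a + - t * b ≡ 1ℤ
    rearrange s t a b eq = trans (cong (λ z → z + - t * b) (sym eq)) (e t b)
      where
      e : ∀ t b → (1ℤ + t * b) + - t * b ≡ 1ℤ
      e = solve-∀
    bézout : Bézout.Identity 1 m n → + m ⟂ + n
    bézout (Bézout.+- x y eq) = + x , - + y , rearrange (+ x) (+ y) (+ m) (+ n) (lift x y m n eq)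
    bézout (Bézout.-+ x y eq) = ⟂-sym {+ n} {+ m} (+ y , - + x , rearrange (+ y) (+ x) (+ n) (+ m) (lift y x n m eq))

  ∣∣-⟂ : ∀ {m n} → + ∣ m ∣ ⟂ n → m ⟂ n
  ∣∣-⟂ {m} {n} h = ⟂-sym {n} {m} (⟂-∣ {n} {+ ∣ m ∣} {m} (⟂-sym {+ ∣ m ∣} {n} h) m∣∣m∣)

  coprime⇒⟂ᶻ : ∀ {m n} → Coprime (∣ m ∣) (∣ n ∣) → m ⟂ n
  coprime⇒⟂ᶻ {m} {n} c = ∣∣-⟂ {m} {n} (⟂-sym {n} {+ ∣ m ∣} (∣∣-⟂ {n} {+ ∣ m ∣} (coprime⇒⟂ (Coprimality.sym c))))

  -- If `a` is even, a factor 2 of `a * a` cancels; if odd, `a` is coprime to 2. Hence the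
  -- congruences modulo q² and p⁴: they give divisibility by q and p² even after halving.
  square∣double⇒∣ : ∀ a U → a * a ∣ᶻ + 2 * U → a ∣ᶻ U
  square∣double⇒∣ a U (divides k 2U≡kaa) = by-cases (+ 2 ∣? a)
    where
    by-cases : _ → a ∣ᶻ U
    by-cases (yes (divides h a≡h2)) = divides (k * h) (*-cancelˡ (+ 2) (λ ()) (trans 2U≡kaa (trans (cong (λ x → k * (x * a)) a≡h2) (e k h a))))
      where
      e : ∀ k h a → k * (h * + 2 * a) ≡ + 2 * (k * h * a)
      e = solve-∀
    by-cases (no 2∤a) = from-bézout (coprime⇒⟂ᶻ {+ 2} {a} (coprime-by-primes (λ {t} pr t∣2 t∣a →
      2∤a (∣ᵤ⇒∣ {+ 2} {a} (subst (ℕ._∣ (∣ a ∣)) (prime∣prime⇒≡ pr prime[2] t∣2) t∣a)))))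
      where
      from-bézout : + 2 ⟂ a → a ∣ᶻ U
      from-bézout (s , t , eq) = divides (s * k * a + t * U)
        (trans (sym (*-identityˡ U)) (trans (cong (_* U) (sym eq)) (trans (e₁ s t a U) (trans (cong (λ x → s * x + t * a * U) 2U≡kaa) (e₂ s t a k U)))))
        where
        e₁ : ∀ s t a U → (s * + 2 + t * a) * U ≡ s * (+ 2 * U) + t * a * U
        e₁ = solve-∀
        e₂ : ∀ s t a k U → s * (k * (a * a)) + t * a * U ≡ (s * k * a + t * U) * a
        e₂ = solve-∀

  shift-away-from-0 : ∀ a b → b ≢ 0ℤ → ∃ λ k → a + k * b ≢ 0ℤ
  shift-away-from-0 a b b≢0 = by-cases (a ≟ 0ℤ)
    where
    by-cases : _ → ∃ λ k → a + k * b ≢ 0ℤ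
    by-cases (yes a≡0) = 1ℤ , λ eq → b≢0 (trans (sym (+-identityˡ b)) (trans (cong₂ _+_ (sym a≡0) (sym (*-identityˡ b))) eq))
    by-cases (no a≢0) = 0ℤ , λ eq → a≢0 (trans (sym (+-identityʳ a)) eq)

  record Residues (G p q : ℤ) : Set where
    field
      B b v w : ℤ
      B≢0 : B ≢ 0ℤ
      B≡ : B ≡ G * b
      1+B≡ : 1ℤ + B ≡ q * q * v
      1-B≡ : 1ℤ - B ≡ p * p * (p * p) * w

  residues : ∀ G p q → G ≢ 0ℤ → p ≢ 0ℤ → q ≢ 0ℤ → G ⟂ p → G ⟂ q → p ⟂ q → Residues G p q
  residues G p q G≢0 p≢0 q≢0 G⟂p G⟂q p⟂q = build
    (⟂-sym {q * q} {G * P} (⟂-* {q * q} {G} {P} (⟂-sym {G} {q * q} (⟂-* {G} {q} {q} G⟂q G⟂q)) (⟂-* {q * q} {p * p} {p * p} qq⟂pp qq⟂pp)))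
    (⟂-sym {P} {G * (q * q)} (⟂-* {P} {G} {q * q} (⟂-sym {G} {P} (⟂-* {G} {p * p} {p * p} G⟂pp G⟂pp)) (⟂-sym {q * q} {P} (⟂-* {q * q} {p * p} {p * p} qq⟂pp qq⟂pp))))
    where
    P = p * p * (p * p)
    G⟂pp : G ⟂ p * p
    G⟂pp = ⟂-* {G} {p} {p} G⟂p G⟂p
    qq⟂p : q * q ⟂ p
    qq⟂p = ⟂-sym {p} {q * q} (⟂-* {p} {q} {q} p⟂q p⟂q)
    qq⟂pp : q * q ⟂ p * p
    qq⟂pp = ⟂-* {q * q} {p} {p} qq⟂p qq⟂p
    module _ (s₁ t₁ s₂ t₂ k : ℤ) where
      value : ℤ
      -- Chinese remaindering: by the Bézout identities in `build`, `s₁ * (G * P)` is 1 modulo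
      -- `q * q` and `s₂ * (G * (q * q))` is 1 modulo `P`. The last summand only serves to avoid the
      -- value 0.
      value = s₂ * (G * (q * q)) - s₁ * (G * P) + k * (G * (P * (q * q)))
      eG : value ≡ G * (s₂ * (q * q) - s₁ * P + k * (P * (q * q)))
      eG = e s₂ s₁ k G P (q * q)
        where
        e : ∀ s₂ s₁ k G P Q → s₂ * (G * Q) - s₁ * (G * P) + k * (G * (P * Q)) ≡ G * (s₂ * Q - s₁ * P + k * (P * Q))
        e = solve-∀
      eq : s₁ * (G * P) + t₁ * (q * q) ≡ 1ℤ → 1ℤ + value ≡ q * q * (s₂ * G + t₁ + k * (G * P))
      eq h = trans (cong (λ x → x + value) (sym h)) (e s₁ t₁ s₂ k G P (q * q))
        where
        e : ∀ s₁ t₁ s₂ k G P Q → (s₁ * (G * P) + t₁ * Q) + (s₂ * (G * Q) - s₁ * (G * P) + k * (G * (P * Q))) ≡ Q * (s₂ * G + t₁ + k * (G * P))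
        e = solve-∀
      ep : s₂ * (G * (q * q)) + t₂ * P ≡ 1ℤ → 1ℤ - value ≡ P * (t₂ + s₁ * G - k * (G * (q * q)))
      ep h = trans (cong (λ x → x - value) (sym h)) (e s₁ t₂ s₂ k G P (q * q))
        where
        e : ∀ s₁ t₂ s₂ k G P Q → (s₂ * (G * Q) + t₂ * P) - (s₂ * (G * Q) - s₁ * (G * P) + k * (G * (P * Q))) ≡ P * (t₂ + s₁ * G - k * (G * Q))
        e = solve-∀
    build : G * P ⟂ q * q → G * (q * q) ⟂ P → Residues G p q
    build (s₁ , t₁ , h₁) (s₂ , t₂ , h₂) = finish
      (shift-away-from-0 (s₂ * (G * (q * q)) - s₁ * (G * P)) (G * (P * (q * q))) (*-≢0 G≢0 (*-≢0 (*-≢0 (*-≢0 p≢0 p≢0) (*-≢0 p≢0 p≢0)) (*-≢0 q≢0 q≢0))))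
      where
      finish : (∃ λ k → value s₁ t₁ s₂ t₂ k ≢ 0ℤ) → Residues G p q
      finish (k , nz) = record
        { B = value s₁ t₁ s₂ t₂ k ; B≢0 = nz ; B≡ = eG s₁ t₁ s₂ t₂ k ; 1+B≡ = eq s₁ t₁ s₂ t₂ k h₁ ; 1-B≡ = ep s₁ t₁ s₂ t₂ k h₂ }

  -- If p q is odd then G ∣ B with an even cofactor and U, X = 1 ± B³; if p q is even then B is odd and U, X = (1 ± B³) / 2.
  record Core (G p q : ℤ) : Set where
    field
      B b e U X U′ X′ v w : ℤ
      B≢0 : B ≢ 0ℤ
      B≡ : B ≡ G * b
      1+B≡ : 1ℤ + B ≡ q * q * v
      1-B≡ : 1ℤ - B ≡ p * p * (p * p) * w
      e≢0 : e ≢ 0ℤ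
      e∣B : e ∣ᶻ B
      2U≡ : + 2 * U ≡ e * (1ℤ + B * B * B)
      2X≡ : + 2 * X ≡ e * (1ℤ - B * B * B)
      U≡ : U ≡ U′ * q
      X≡ : X ≡ X′ * (p * p)
      X⟂B : X ⟂ B

  module _ {G p q : ℤ} where

    cube-factor₊ : ∀ B → 1ℤ + B * B * B ≡ (1ℤ + B) * (1ℤ - B + B * B)
    cube-factor₊ = solve-∀
    cube-factor₋ : ∀ B → 1ℤ - B * B * B ≡ (1ℤ - B) * (1ℤ + B + B * B)
    cube-factor₋ = solve-∀

    -- 1 + B divides 1 + B³, so q² divides 2U; likewise p⁴ divides 2X. `square∣double⇒∣` then yields
    -- `U′` and `X′`.
    core : ∀ {H} (R : Residues H p q) (e b : ℤ) → Residues.B R ≡ G * b → e ≢ 0ℤ → e ∣ᶻ Residues.B R →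
      ∀ U X → let B = Residues.B R in
      + 2 * U ≡ e * (1ℤ + B * B * B) → + 2 * X ≡ e * (1ℤ - B * B * B) → X ⟂ B → Core G p q
    core R e b B≡ e≢0 e∣B U X 2U≡ 2X≡ X⟂B = finish
      (square∣double⇒∣ q U (divides (e * v * (1ℤ - B + B * B))
        (trans 2U≡ (trans (cong (e *_) (trans (cube-factor₊ B) (cong (_* (1ℤ - B + B * B)) 1+B≡))) (e₁ e (q * q) v (1ℤ - B + B * B))))))
      (square∣double⇒∣ (p * p) X (divides (e * w * (1ℤ + B + B * B))
        (trans 2X≡ (trans (cong (e *_) (trans (cube-factor₋ B) (cong (_* (1ℤ + B + B * B)) 1-B≡))) (e₁ e (p * p * (p * p)) w (1ℤ + B + B * B))))))
      where
      open Residues R using (B; v; w; B≢0; 1+B≡; 1-B≡)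
      e₁ : ∀ e Q v c → e * (Q * v * c) ≡ e * v * c * Q
      e₁ = solve-∀
      finish : q ∣ᶻ U → p * p ∣ᶻ X → Core G p q
      finish (divides U′ U≡) (divides X′ X≡) = record
        { B = B ; b = b ; e = e ; U = U ; X = X ; U′ = U′ ; X′ = X′ ; v = v ; w = w
        ; B≢0 = B≢0 ; B≡ = B≡ ; 1+B≡ = 1+B≡ ; 1-B≡ = 1-B≡ ; e≢0 = e≢0 ; e∣B = e∣B
        ; 2U≡ = 2U≡ ; 2X≡ = 2X≡ ; U≡ = U≡ ; X≡ = X≡ ; X⟂B = X⟂B }

    core-odd : Residues (G * + 2) p q → Core G p q
    -- The extra factor 2 in the modulus makes `e = 2` divide `B`.
    core-odd R = core R (+ 2) (+ 2 * b) (trans B≡ (*-assoc G (+ 2) b)) (λ ()) (divides (G * b) (trans B≡ (e₁ G b)))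
      (1ℤ + B * B * B) (1ℤ - B * B * B) refl refl (1ℤ , B * B , e₂ B)
      where
      open Residues R
      e₁ : ∀ G b → G * + 2 * b ≡ G * b * + 2
      e₁ = solve-∀
      e₂ : ∀ B → 1ℤ * (1ℤ - B * B * B) + B * B * B ≡ 1ℤ
      e₂ = solve-∀

    -- 1 + B or 1 - B is a multiple of an even number, so `B` is odd. Thus U = (1 + B³) / 2 is an
    -- integer, and X = 1 - U.
    core-even : Residues G p q → + 2 ∣ᶻ p * q → Core G p q
    core-even R 2∣pq = finish 2∣1+B³
      where
      open Residues R
      2∣1+B : + 2 ∣ᶻ 1ℤ + B
      2∣1+B = [ (λ 2∣p → from-1-B (subst (+ 2 ∣ᶻ_) (trans (e₁ p w) (sym 1-B≡)) (∣m⇒∣m*n {+ 2} {p} (p * (p * p) * w) 2∣p)))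
              , (λ 2∣q → subst (+ 2 ∣ᶻ_) (trans (sym (*-assoc q q v)) (sym 1+B≡)) (∣m⇒∣m*n {+ 2} {q} (q * v) 2∣q)) ]′ (euclid prime[2] p q 2∣pq)
        where
        e₁ : ∀ p w → p * (p * (p * p) * w) ≡ p * p * (p * p) * w
        e₁ = solve-∀
        e₂ : ∀ B → + 2 - (1ℤ - B) ≡ 1ℤ + B
        e₂ = solve-∀
        from-1-B : + 2 ∣ᶻ 1ℤ - B → + 2 ∣ᶻ 1ℤ + B
        from-1-B h = subst (+ 2 ∣ᶻ_) (e₂ B) (∣m∣n⇒∣m-n {+ 2} {+ 2} {1ℤ - B} (∣-refl {+ 2}) h)
      2∣1+B³ : + 2 ∣ᶻ 1ℤ + B * B * B
      2∣1+B³ = subst (+ 2 ∣ᶻ_) (sym (cube-factor₊ B)) (∣m⇒∣m*n {+ 2} {1ℤ + B} (1ℤ - B + B * B) 2∣1+B)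
      finish : + 2 ∣ᶻ 1ℤ + B * B * B → Core G p q
      finish (divides U 1+B³≡) = core R 1ℤ b B≡ (λ ()) (divides B (sym (*-identityʳ B))) U (1ℤ - U)
        (trans (*-comm (+ 2) U) (trans (sym 1+B³≡) (sym (*-identityˡ _))))
        (trans (e₁ U) (trans (cong (λ x → + 2 - x) (sym 1+B³≡)) (e₂ B)))
        -- The Bézout identity 2 X + B² B = 1.
        (+ 2 , B * B , trans (cong (_+ B * B * B) (trans (e₁ U) (cong (λ x → + 2 - x) (sym 1+B³≡)))) (e₃ B))
        where
        e₁ : ∀ U → + 2 * (1ℤ - U) ≡ + 2 - U * + 2
        e₁ = solve-∀
        e₂ : ∀ B → + 2 - (1ℤ + B * B * B) ≡ 1ℤ * (1ℤ - B * B * B)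
        e₂ = solve-∀
        e₃ : ∀ B → + 2 - (1ℤ + B * B * B) + B * B * B ≡ 1ℤ
        e₃ = solve-∀

  -- The base solution built from `B`.

  ∣1⇒²≡1 : ∀ x → x ∣ᶻ 1ℤ → x * x ≡ 1ℤ
  ∣1⇒²≡1 x x∣1 = unit x (ℕ.∣1⇒≡1 (∣⇒∣ᵤ {x} {1ℤ} x∣1))
    where
    unit : ∀ x → ∣ x ∣ ≡ 1 → x * x ≡ 1ℤ
    unit (+ 1) refl = refl
    unit -[1+ 0 ] refl = refl

  -- 4 y is the difference of the squares of 1 + y and 1 - y, and units have square 1.
  1+y∣1∧1-y∣1⇒y≡0 : ∀ y → 1ℤ + y ∣ᶻ 1ℤ → 1ℤ - y ∣ᶻ 1ℤ → y ≡ 0ℤ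
  1+y∣1∧1-y∣1⇒y≡0 y h₊ h₋ = *-cancelˡ (+ 4) {y} {0ℤ} (λ ()) (trans (e y) (cong₂ _-_ (∣1⇒²≡1 (1ℤ + y) h₊) (∣1⇒²≡1 (1ℤ - y) h₋)))
    where
    e : ∀ y → + 4 * y ≡ (1ℤ + y) * (1ℤ + y) - (1ℤ - y) * (1ℤ - y)
    e = solve-∀

  1+even≢0 : ∀ y₁ → 1ℤ + + 2 * y₁ ≢ 0ℤ
  1+even≢0 y₁ eq = contradiction (ℕ.∣1⇒≡1 (∣⇒∣ᵤ {+ 2} {1ℤ} (divides (- y₁) (trans (e y₁) (trans (cong (_- + 2 * y₁) eq) (e′ y₁)))))) (λ ())
    where
    e : ∀ y₁ → 1ℤ ≡ 1ℤ + + 2 * y₁ - + 2 * y₁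
    e = solve-∀
    e′ : ∀ y₁ → 0ℤ - + 2 * y₁ ≡ - y₁ * + 2
    e′ = solve-∀

  module FromCore (c₀ c₁ c₂ p q m C f : ℤ) (c₀≢0 : c₀ ≢ 0ℤ) (c₁≢0 : c₁ ≢ 0ℤ) (c₂≢0 : c₂ ≢ 0ℤ)
    (c₀≡ : c₀ ≡ p * q * m) (c₂≡ : c₂ ≡ q * C * f) (squareful-m : Squareful m) (squareful-C : Squareful C)
    (supported-C : ∀ {t} → Prime t → + t ∣ᶻ C → + t ∣ᶻ p * q) where

    -- `y` is even, so that 1 ± y are non-zero, and a multiple of `c₀`, so that `Q` is 1 modulo p q.
    -- Its other factors turn -θ y² / c₁ into -(2 c₀)² c₂³ c₁³ a₂, which is squareful.
    y₁ y Q G : ℤ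
    y₁ = c₀ * (c₂ * (c₁ * c₁))
    y = + 2 * y₁
    Q = (1ℤ + y) * (1ℤ - y)
    G = m * (f * Q)

    p≢0 : p ≢ 0ℤ
    p≢0 = ≢0-*ˡ (≢0-*ˡ (subst (_≢ 0ℤ) c₀≡ c₀≢0))
    q≢0 : q ≢ 0ℤ
    q≢0 = ≢0-*ˡ (≢0-*ˡ (subst (_≢ 0ℤ) c₂≡ c₂≢0))
    m≢0 : m ≢ 0ℤ
    m≢0 = ≢0-*ʳ {p * q} (subst (_≢ 0ℤ) c₀≡ c₀≢0)
    C≢0 : C ≢ 0ℤ
    C≢0 = ≢0-*ʳ {q} (≢0-*ˡ (subst (_≢ 0ℤ) c₂≡ c₂≢0))
    f≢0 : f ≢ 0ℤ
    f≢0 = ≢0-*ʳ {q * C} (subst (_≢ 0ℤ) c₂≡ c₂≢0)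
    y₁≢0 : y₁ ≢ 0ℤ
    y₁≢0 = *-≢0 c₀≢0 (*-≢0 c₂≢0 (*-≢0 c₁≢0 c₁≢0))
    y≢0 : y ≢ 0ℤ
    y≢0 = *-≢0 {m = + 2} (λ ()) y₁≢0
    1+y≢0 : 1ℤ + y ≢ 0ℤ
    1+y≢0 = 1+even≢0 y₁
    1-y≢0 : 1ℤ - y ≢ 0ℤ
    1-y≢0 = subst (_≢ 0ℤ) (cong (λ x → 1ℤ + x) (sym (neg-distribʳ-* (+ 2) y₁))) (1+even≢0 (- y₁))
    Q≢0 : Q ≢ 0ℤ
    Q≢0 = *-≢0 1+y≢0 1-y≢0
    G≢0 : G ≢ 0ℤ
    G≢0 = *-≢0 m≢0 (*-≢0 f≢0 Q≢0)

    Q⟂pq : Q ⟂ p * q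
    Q⟂pq = 1ℤ , + 4 * (p * q * (m * m) * (c₂ * (c₁ * c₁) * (c₂ * (c₁ * c₁)))) ,
      trans (cong (λ z → 1ℤ * ((1ℤ + + 2 * (z * (c₂ * (c₁ * c₁)))) * (1ℤ - + 2 * (z * (c₂ * (c₁ * c₁))))) + + 4 * (p * q * (m * m) * (c₂ * (c₁ * c₁) * (c₂ * (c₁ * c₁)))) * (p * q)) c₀≡)
        (e (p * q) m (c₂ * (c₁ * c₁)))
      where
      e : ∀ d m k → 1ℤ * ((1ℤ + + 2 * (d * m * k)) * (1ℤ - + 2 * (d * m * k))) + + 4 * (d * (m * m) * (k * k)) * d ≡ 1ℤ
      e = solve-∀

    module _ (cr : Core G p q) where
      open Core cr

      U+X≡e : U + X ≡ e
      U+X≡e = *-cancelˡ (+ 2) (λ ()) (trans (*-distribˡ-+ (+ 2) U X) (trans (cong₂ _+_ 2U≡ 2X≡) (h e (B * B * B))))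
        where
        h : ∀ e B³ → e * (1ℤ + B³) + e * (1ℤ - B³) ≡ + 2 * e
        h = solve-∀

      U-X≡eB³ : U - X ≡ e * (B * B * B)
      U-X≡eB³ = *-cancelˡ (+ 2) (λ ()) (trans (h₁ U X) (trans (cong₂ _-_ 2U≡ 2X≡) (h₂ e (B * B * B))))
        where
        h₁ : ∀ U X → + 2 * (U - X) ≡ + 2 * U - + 2 * X
        h₁ = solve-∀
        h₂ : ∀ e B³ → e * (1ℤ + B³) - e * (1ℤ - B³) ≡ + 2 * (e * B³)
        h₂ = solve-∀

      -- `B` is a multiple of 1 + y and of 1 - y, which are not both units as `y` is non-zero. This
      -- keeps 1 ± B³ away from 0.
      B∤1 : ¬ (B ∣ᶻ 1ℤ)
      B∤1 B∣1 = y≢0 (1+y∣1∧1-y∣1⇒y≡0 y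
        (∣-trans {1ℤ + y} {B} {1ℤ} (divides (m * f * (1ℤ - y) * b) (trans B≡ (h₁ m f (1ℤ + y) (1ℤ - y) b))) B∣1)
        (∣-trans {1ℤ - y} {B} {1ℤ} (divides (m * f * (1ℤ + y) * b) (trans B≡ (h₂ m f (1ℤ + y) (1ℤ - y) b))) B∣1))
        where
        h₁ : ∀ m f x z b → m * (f * (x * z)) * b ≡ m * f * z * b * x
        h₁ = solve-∀
        h₂ : ∀ m f x z b → m * (f * (x * z)) * b ≡ m * f * x * b * z
        h₂ = solve-∀

      1+B³≢0 : 1ℤ + B * B * B ≢ 0ℤ
      1+B³≢0 eq = B∤1 (divides (- (B * B)) (trans (h₁ B) (trans (cong (_- B * B * B) eq) (h₂ B))))
        where
        h₁ : ∀ B → 1ℤ ≡ 1ℤ + B * B * B - B * B * B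
        h₁ = solve-∀
        h₂ : ∀ B → 0ℤ - B * B * B ≡ - (B * B) * B
        h₂ = solve-∀

      1-B³≢0 : 1ℤ - B * B * B ≢ 0ℤ
      1-B³≢0 eq = B∤1 (divides (B * B) (trans (h₁ B) (trans (cong (_+ B * B * B) eq) (+-identityˡ (B * B * B)))))
        where
        h₁ : ∀ B → 1ℤ ≡ 1ℤ - B * B * B + B * B * B
        h₁ = solve-∀

      U≢0 : U ≢ 0ℤ
      U≢0 = ≢0-*ʳ {+ 2} (subst (_≢ 0ℤ) (sym 2U≡) (*-≢0 e≢0 1+B³≢0))
      X≢0 : X ≢ 0ℤ
      X≢0 = ≢0-*ʳ {+ 2} (subst (_≢ 0ℤ) (sym 2X≡) (*-≢0 e≢0 1-B³≢0))
      X′≢0 : X′ ≢ 0ℤ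
      X′≢0 = ≢0-*ˡ (subst (_≢ 0ℤ) X≡ X≢0)
      b≢0 : b ≢ 0ℤ
      b≢0 = ≢0-*ʳ {G} (subst (_≢ 0ℤ) B≡ B≢0)

      -- `a₀` is u X² / c₀ with X = X′ p², and `a₂` is solved from `balance`: m q C e² (G b)³ = c₂
      -- a₂ Q. With U = U′ q, `a₃` becomes m C q³ U′², which is squareful.
      u a₀ a₁ a₂ a₃ : ℤ
      u = m * q * C
      a₀ = C * (p ² * p) * X′ ²
      a₂ = e ² * (m ² * m ² * (f ² * Q ²) * (b ² * b))
      a₁ = - ((+ 2 * c₀) ² * (c₂ ² * c₂) * (c₁ ² * c₁) * a₂)
      a₃ = u * U ²

      a₂≢0 : a₂ ≢ 0ℤ
      a₂≢0 = *-≢0 (*-≢0 e≢0 e≢0) (*-≢0 (*-≢0 (*-≢0 (*-≢0 m≢0 m≢0) (*-≢0 m≢0 m≢0)) (*-≢0 (*-≢0 f≢0 f≢0) (*-≢0 Q≢0 Q≢0))) (*-≢0 (*-≢0 b≢0 b≢0) b≢0))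

      squareful-a₂ : Squareful a₂
      squareful-a₂ = Squareful-* {e ²} (Squareful-² e) (Squareful-* {m ² * m ² * (f ² * Q ²)} {b ² * b}
        (Squareful-* {m ² * m ²} {f ² * Q ²} (Squareful-² (m ²)) (Squareful-* {f ²} {Q ²} (Squareful-² f) (Squareful-² Q))) (Squareful-³ b))

      Squareful-neg : ∀ {x} → Squareful x → Squareful (- x)
      Squareful-neg {x} = subst Squarefulℕ (sym (∣-i∣≡∣i∣ x))

      -- `B` is 1 modulo p and -1 modulo q, the primes of `C` divide p q, and `X′` divides `X`,
      -- which is coprime to `B`.
      a₀⟂B : a₀ ⟂ B
      a₀⟂B = ⟂-sym {B} {a₀} (⟂-* {B} {C * (p ² * p)} {X′ ²}
        (⟂-* {B} {C} {p ² * p} B⟂C (⟂-* {B} {p ²} {p} (⟂-* {B} {p} {p} B⟂p B⟂p) B⟂p))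
        (⟂-* {B} {X′} {X′} B⟂X′ B⟂X′))
        where
        B⟂p : B ⟂ p
        B⟂p = 1ℤ , p * (p * p) * w , trans (cong (λ x → 1ℤ * B + x) (trans (h₁ p w) (sym 1-B≡))) (h₂ B)
          where
          h₁ : ∀ p w → p * (p * p) * w * p ≡ p * p * (p * p) * w
          h₁ = solve-∀
          h₂ : ∀ B → 1ℤ * B + (1ℤ - B) ≡ 1ℤ
          h₂ = solve-∀
        B⟂q : B ⟂ q
        B⟂q = -1ℤ , q * v , trans (cong (λ x → -1ℤ * B + x) (trans (h₁ q v) (sym 1+B≡))) (h₂ B)
          where
          h₁ : ∀ q v → q * v * q ≡ q * q * v
          h₁ = solve-∀
          h₂ : ∀ B → -1ℤ * B + (1ℤ + B) ≡ 1ℤ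
          h₂ = solve-∀
        B⟂X′ : B ⟂ X′
        B⟂X′ = ⟂-∣ {B} {X} {X′} (⟂-sym {X} {B} X⟂B) (divides (p * p) (trans X≡ (*-comm X′ (p * p))))
        B⟂C : B ⟂ C
        B⟂C = coprime⇒⟂ᶻ {B} {C} (coprime-by-primes (λ {t} pr t∣B t∣C →
          ⟂-no-common-prime pr (⟂-* {B} {p} {q} B⟂p B⟂q) (∣ᵤ⇒∣ {+ t} {B} t∣B) (supported-C pr (∣ᵤ⇒∣ {+ t} {C} t∣C))))

      a₀⟂a₂ : a₀ ⟂ a₂
      -- e² m B³ equals f Q a₂, and it is coprime to `a₀` because `e` and `m` divide `B`.
      a₀⟂a₂ = ⟂-∣ {a₀} {e * e * (m * (B * B * B))} {a₂}
        (⟂-* {a₀} {e * e} {m * (B * B * B)} (⟂-* {a₀} {e} {e} ⟂e ⟂e) (⟂-* {a₀} {m} {B * B * B} ⟂m (⟂-* {a₀} {B * B} {B} (⟂-* {a₀} {B} {B} a₀⟂B a₀⟂B) a₀⟂B)))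
        (divides (f * Q) (trans (cong (λ B → e * e * (m * (B * B * B))) B≡) (h e m f Q b)))
        where
        ⟂e : a₀ ⟂ e
        ⟂e = ⟂-∣ {a₀} {B} {e} a₀⟂B e∣B
        ⟂m : a₀ ⟂ m
        ⟂m = ⟂-∣ {a₀} {B} {m} a₀⟂B (divides (f * Q * b) (trans B≡ (h′ m (f * Q) b)))
          where
          h′ : ∀ m k b → m * k * b ≡ k * b * m
          h′ = solve-∀
        h : ∀ e m f Q b → e * e * (m * (m * (f * Q) * b * (m * (f * Q) * b) * (m * (f * Q) * b)))
          ≡ f * Q * (e * e * (m * m * (m * m) * (f * f * (Q * Q)) * (b * b * b)))
        h = solve-∀

      baseSolution : BaseSolution c₀ c₁ c₂
      baseSolution = record
        { a₀ = a₀ ; a₁ = a₁ ; a₂ = a₂ ; a₃ = a₃ ; u = u ; θ = c₂ * a₂ ; U = U ; X = X ; y = y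
        ; a₀≢0 = *-≢0 (*-≢0 C≢0 (*-≢0 (*-≢0 p≢0 p≢0) p≢0)) (*-≢0 X′≢0 X′≢0)
        ; a₁≢0 = λ eq → *-≢0 (*-≢0 (*-≢0 (*-≢0 2c₀≢0 2c₀≢0) (*-≢0 (*-≢0 c₂≢0 c₂≢0) c₂≢0)) (*-≢0 (*-≢0 c₁≢0 c₁≢0) c₁≢0)) a₂≢0
                   (trans (sym (neg-involutive _)) (cong -_ eq))
        ; a₂≢0 = a₂≢0
        ; a₃≢0 = *-≢0 (*-≢0 (*-≢0 m≢0 q≢0) C≢0) (*-≢0 U≢0 U≢0)
        ; squareful₀ = Squareful-*² {C * (p ² * p)} X′ (Squareful-* {C} {p ² * p} squareful-C (Squareful-³ p))
        ; squareful₁ = Squareful-neg {(+ 2 * c₀) ² * (c₂ ² * c₂) * (c₁ ² * c₁) * a₂} (Squareful-* {(+ 2 * c₀) ² * (c₂ ² * c₂) * (c₁ ² * c₁)} {a₂}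
            (Squareful-* {(+ 2 * c₀) ² * (c₂ ² * c₂)} {c₁ ² * c₁} (Squareful-* {(+ 2 * c₀) ²} {c₂ ² * c₂} (Squareful-² (+ 2 * c₀)) (Squareful-³ c₂)) (Squareful-³ c₁)) squareful-a₂)
        ; squareful₂ = squareful-a₂
        ; squareful₃ = subst Squareful (trans (h₃ m C q U′) (cong (λ U → m * q * C * (U * U)) (sym U≡)))
            (Squareful-*² {m * C * (q ² * q)} U′ (Squareful-* {m * C} {q ² * q} (Squareful-* {m} {C} squareful-m squareful-C) (Squareful-³ q)))
        ; coprime₀₂ = a₀⟂a₂
        ; eq₀ = trans (cong (_* a₀) c₀≡) (trans (h₀ p q m C X′) (cong (λ X → m * q * C * (X * X)) (sym X≡)))
        ; eq₁ = h₁ c₀ c₁ c₂ a₂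
        ; eq₂ = refl
        ; eq₃ = refl
        ; balance = trans (cong₂ (λ α β → u * (α * β)) U+X≡e U-X≡eB³)
            (trans (cong (λ B → u * (e * (e * (B * B * B)))) B≡) (trans (h₄ q C m f Q b e) (cong (λ c → c * a₂ * Q) (sym c₂≡))))
        ; U≢0 = U≢0 ; X≢0 = X≢0 ; y≢0 = y≢0
        ; U+X≢0 = subst (_≢ 0ℤ) (sym U+X≡e) e≢0
        ; U-X≢0 = subst (_≢ 0ℤ) (sym U-X≡eB³) (*-≢0 e≢0 (*-≢0 (*-≢0 B≢0 B≢0) B≢0))
        ; 1+y≢0 = 1+y≢0
        ; 1-y≢0 = 1-y≢0
        }
        where
        2c₀≢0 : + 2 * c₀ ≢ 0ℤ
        2c₀≢0 = *-≢0 {m = + 2} (λ ()) c₀≢0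
        h₀ : ∀ p q m C X′ → p * q * m * (C * (p * p * p) * (X′ * X′)) ≡ m * q * C * (X′ * (p * p) * (X′ * (p * p)))
        h₀ = solve-∀
        h₁ : ∀ c₀ c₁ c₂ a₂ → c₁ * - (+ 2 * c₀ * (+ 2 * c₀) * (c₂ * c₂ * c₂) * (c₁ * c₁ * c₁) * a₂)
          ≡ - (c₂ * a₂ * (+ 2 * (c₀ * (c₂ * (c₁ * c₁))) * (+ 2 * (c₀ * (c₂ * (c₁ * c₁))))))
        h₁ = solve-∀
        h₃ : ∀ m C q U′ → m * C * (q * q * q) * (U′ * U′) ≡ m * q * C * (U′ * q * (U′ * q))
        h₃ = solve-∀
        h₄ : ∀ q C m f Q b e → m * q * C * (e * (e * (m * (f * Q) * b * (m * (f * Q) * b) * (m * (f * Q) * b))))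
          ≡ q * C * f * (e * e * (m * m * (m * m) * (f * f * (Q * Q)) * (b * b * b))) * Q
        h₄ = solve-∀

  -- The sign goes into the second factor: `m` and `f` will carry the signs of `c₀` and `c₂`, while
  -- p, q and C stay natural numbers.
  signed-cofactor : ∀ c {a b} → ∣ c ∣ ≡ a ℕ.* b → c ≡ + a * (sign c ◃ b)
  signed-cofactor c {a} {b} eq = trans (sym (signᵢ◃∣i∣≡i c)) (trans (cong (sign c ◃_) eq)
    (trans (◃-distrib-* Sign.+ (sign c) a b) (cong (_* (sign c ◃ b)) (+◃n≡+n a))))

  exists-base : ∀ c₀ c₁ c₂ → c₀ ≢ 0ℤ → c₁ ≢ 0ℤ → c₂ ≢ 0ℤ → BaseSolution c₀ c₁ c₂
  exists-base c₀ c₁ c₂ c₀≢0 c₁≢0 c₂≢0 = from-split (joint-split (∣ c₀ ∣) (∣ c₂ ∣) (positive c₀≢0) (positive c₂≢0))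
    where
    positive : ∀ {c} → c ≢ 0ℤ → 0 < ∣ c ∣
    positive c≢0 = ℕ.n≢0⇒n>0 (λ eq → c≢0 (∣i∣≡0⇒i≡0 eq))
    from-split : JointSplit (∣ c₀ ∣) (∣ c₂ ∣) → BaseSolution c₀ c₁ c₂
    from-split split = by-parity (+ 2 ∣? + p * + q)
      where
      open JointSplit split renaming (m to m₀; f to f₀)
      m f : ℤ
      m = sign c₀ ◃ m₀
      f = sign c₂ ◃ f₀
      c₀≡ : c₀ ≡ + p * + q * m
      c₀≡ = trans (signed-cofactor c₀ {p ℕ.* q} {m₀} n₀≡) (cong (_* m) (pos-* p q))
      c₂≡ : c₂ ≡ + q * + C * f
      c₂≡ = trans (signed-cofactor c₂ {q ℕ.* C} {f₀} n₂≡) (cong (_* f) (pos-* q C))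
      open FromCore c₀ c₁ c₂ (+ p) (+ q) m (+ C) f c₀≢0 c₁≢0 c₂≢0 c₀≡ c₂≡
        (subst Squarefulℕ (sym (abs-◃ (sign c₀) m₀)) squareful-m) squareful-C
        (λ {t} pr t∣C → subst (+ t ∣ᶻ_) (pos-* p q) (∣ᵤ⇒∣ {+ t} {+ (p ℕ.* q)} (supported-C pr (∣⇒∣ᵤ {+ t} {+ C} t∣C))))
      ◃⟂ : ∀ s {n} → Coprime n (p ℕ.* q) → s ◃ n ⟂ + p * + q
      ◃⟂ s {n} co = coprime⇒⟂ᶻ {s ◃ n} {+ p * + q} (subst₂ Coprime (sym (abs-◃ s n)) (sym (abs-* (+ p) (+ q))) co)
      pq⟂G : + p * + q ⟂ G
      pq⟂G = ⟂-* {+ p * + q} {m} {f * Q} (⟂-sym {m} {+ p * + q} (◃⟂ (sign c₀) coprime-m))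
        (⟂-* {+ p * + q} {f} {Q} (⟂-sym {f} {+ p * + q} (◃⟂ (sign c₂) coprime-f)) (⟂-sym {Q} {+ p * + q} Q⟂pq))
      solve-residues : ∀ H → H ≢ 0ℤ → + p * + q ⟂ H → Residues H (+ p) (+ q)
      solve-residues H H≢0 pq⟂H = residues H (+ p) (+ q) H≢0 p≢0 q≢0
        (⟂-∣ {H} {+ p * + q} {+ p} H⟂pq (divides (+ q) (*-comm (+ p) (+ q)))) (⟂-∣ {H} {+ p * + q} {+ q} H⟂pq (divides (+ p) refl))
        (coprime⇒⟂ coprime-pq)
        where
        H⟂pq = ⟂-sym {+ p * + q} {H} pq⟂H
      by-parity : _ → BaseSolution c₀ c₁ c₂
      by-parity (yes 2∣pq) = baseSolution (core-even {G} (solve-residues G G≢0 pq⟂G) 2∣pq)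
      by-parity (no 2∤pq) = baseSolution (core-odd {G} (solve-residues (G * + 2) (*-≢0 {n = + 2} G≢0 (λ ()))
        (⟂-* {+ p * + q} {G} {+ 2} pq⟂G pq⟂2)))
        where
        pq⟂2 : + p * + q ⟂ + 2
        pq⟂2 = coprime⇒⟂ᶻ {+ p * + q} {+ 2} (coprime-by-primes (λ {t} pr t∣pq t∣2 →
          2∤pq (∣ᵤ⇒∣ {+ 2} {+ p * + q} (subst (ℕ._∣ (∣ + p * + q ∣)) (prime∣prime⇒≡ pr prime[2] t∣2) t∣pq))))

  -- From the number of points to the bound of order B log B.

  ∣18! : ∀ d → 0 < d → d < 19 → d ℕ.∣ 18 ℕ.!
  ∣18! (suc d) _ (s≤s d<18) = ℕ.∣-trans (ℕ.m∣m*n (d ℕ.!)) (ℕ.m≤n⇒m!∣n! d<18)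

  18!≢0 : 18 ℕ.! ≢ 0
  18!≢0 ()

  n<2^n : ∀ n → n < 2 ℕ.^ n
  n<2^n zero    = s≤s z≤n
  n<2^n (suc n) = ℕ.≤-trans (ℕ.+-mono-≤ (ℕ.m^n>0 2 n) (n<2^n n)) (ℕ.≤-reflexive (cong (2 ℕ.^ n ℕ.+_) (sym (ℕ.+-identityʳ (2 ℕ.^ n)))))

  -- Searches upwards from `E = 0`; the fuel `B` suffices because κ 4^E exceeds `B` as soon as
  -- `E ≥ B`.
  scale : ∀ κ B → 0 < κ → κ ≤ B → ∃ λ E → κ ℕ.* (2 ℕ.^ E ℕ.* 2 ℕ.^ E) ≤ B × B < κ ℕ.* (2 ℕ.^ suc E ℕ.* 2 ℕ.^ suc E)
  scale κ B κ>0 κ≤B = search B 0 (subst (_≤ B) (sym (ℕ.*-identityʳ κ)) κ≤B) (subst (B ≤_) (sym (ℕ.+-identityʳ B)) ℕ.≤-refl)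
    where
    open ℕ.≤-Reasoning
    B<4^ : ∀ E → B ≤ E → B < κ ℕ.* (2 ℕ.^ E ℕ.* 2 ℕ.^ E)
    B<4^ E B≤E = begin-strict
      B                               ≤⟨ B≤E ⟩
      E                               <⟨ n<2^n E ⟩
      2 ℕ.^ E                         ≤⟨ ℕ.m≤m*n (2 ℕ.^ E) (2 ℕ.^ E) {{ℕ.m^n≢0 2 E}} ⟩
      2 ℕ.^ E ℕ.* 2 ℕ.^ E             ≤⟨ ℕ.m≤n*m _ κ {{ℕ.>-nonZero κ>0}} ⟩
      κ ℕ.* (2 ℕ.^ E ℕ.* 2 ℕ.^ E)     ∎
    search : ∀ fuel E → κ ℕ.* (2 ℕ.^ E ℕ.* 2 ℕ.^ E) ≤ B → B ≤ fuel ℕ.+ E →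
      ∃ λ E → κ ℕ.* (2 ℕ.^ E ℕ.* 2 ℕ.^ E) ≤ B × B < κ ℕ.* (2 ℕ.^ suc E ℕ.* 2 ℕ.^ suc E)
    search zero E lo B≤E = contradiction (B<4^ E B≤E) (ℕ.≤⇒≯ lo)
    search (suc fuel) E lo B≤ with κ ℕ.* (2 ℕ.^ suc E ℕ.* 2 ℕ.^ suc E) ℕ.≤? B
    ... | yes lo′ = search fuel (suc E) lo′ (subst (B ≤_) (sym (ℕ.+-suc fuel E)) B≤)
    ... | no hi = E , lo , ℕ.≰⇒> hi

  -- The crude `κ < 2 ^ κ` stands in for the logarithm of `κ` and costs only a constant factor.
  log-bound : ∀ κ B E → 0 < κ → B < κ ℕ.* (2 ℕ.^ suc E ℕ.* 2 ℕ.^ suc E) → ⌊log₂ B ⌋ ≤ (κ ℕ.+ 2) ℕ.* suc E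
  log-bound κ B E κ>0 B< = begin
    ⌊log₂ B ⌋                              ≤⟨ ⌊log₂⌋-mono-≤ (ℕ.≤-trans (ℕ.<⇒≤ B<) (ℕ.*-monoˡ-≤ (2 ℕ.^ suc E ℕ.* 2 ℕ.^ suc E) (ℕ.<⇒≤ (n<2^n κ)))) ⟩
    ⌊log₂ 2 ℕ.^ κ ℕ.* (2 ℕ.^ suc E ℕ.* 2 ℕ.^ suc E) ⌋ ≡⟨ cong ⌊log₂_⌋ (trans (cong (2 ℕ.^ κ ℕ.*_) (sym (ℕ.^-distribˡ-+-* 2 (suc E) (suc E)))) (sym (ℕ.^-distribˡ-+-* 2 κ (suc E ℕ.+ suc E)))) ⟩
    ⌊log₂ 2 ℕ.^ (κ ℕ.+ (suc E ℕ.+ suc E)) ⌋ ≡⟨ ⌊log₂[2^n]⌋≡n (κ ℕ.+ (suc E ℕ.+ suc E)) ⟩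
    κ ℕ.+ (suc E ℕ.+ suc E)                ≤⟨ ℕ.+-monoˡ-≤ (suc E ℕ.+ suc E) (ℕ.m≤m*n κ (suc E)) ⟩
    κ ℕ.* suc E ℕ.+ (suc E ℕ.+ suc E)      ≡⟨ e κ (suc E) ⟩
    (κ ℕ.+ 2) ℕ.* suc E                    ∎
    where
    open ℕ.≤-Reasoning
    e : ∀ κ E → κ ℕ.* E ℕ.+ (E ℕ.+ E) ≡ (κ ℕ.+ 2) ℕ.* E
    e = ℕ.solve-∀

  -- Compensates the rounding in the division by 2 that defines `N`: the unit possibly lost is at
  -- most `n ℕ./ 2`.
  ≤3*half : ∀ n → 2 ≤ n → n ≤ 3 ℕ.* (n ℕ./ 2)
  ≤3*half n 2≤n = begin
    n                                ≡⟨ ℕ.m≡m%n+[m/n]*n n 2 ⟩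
    n ℕ.% 2 ℕ.+ n ℕ./ 2 ℕ.* 2        ≤⟨ ℕ.+-monoˡ-≤ _ (ℕ.≤-pred (ℕ.m%n<n n 2)) ⟩
    1 ℕ.+ n ℕ./ 2 ℕ.* 2              ≤⟨ ℕ.+-monoˡ-≤ _ (ℕ.m≥n⇒m/n>0 2≤n) ⟩
    n ℕ./ 2 ℕ.+ n ℕ./ 2 ℕ.* 2        ≡⟨ e (n ℕ./ 2) ⟩
    3 ℕ.* (n ℕ./ 2)                  ∎
    where
    open ℕ.≤-Reasoning
    e : ∀ h → h ℕ.+ h ℕ.* 2 ≡ 3 ℕ.* h
    e = ℕ.solve-∀

  -- The constant 48 is 4 · 4 · 3: from passing to `suc E` in the upper bound for `B`, from the
  -- solution count, and from `≤3*half`.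
  B-log-B-bound : ∀ {κ} (count : ℕ → ℕ) → 0 < κ →
    (∀ B E → κ ℕ.* (2 ℕ.^ E ℕ.* 2 ℕ.^ E) ≤ B → suc E ℕ.* (2 ℕ.^ E ℕ.* 2 ℕ.^ E) ≤ 4 ℕ.* count B) →
    ∀ B → κ ℕ.* 4 ≤ B → B ℕ.* ⌊log₂ B ⌋ ≤ 48 ℕ.* (κ ℕ.* (κ ℕ.+ 2)) ℕ.* (count B ℕ./ 2)
  B-log-B-bound {κ} count κ>0 many B 4κ≤B with scale κ B κ>0 (ℕ.≤-trans (ℕ.m≤m*n κ 4) 4κ≤B)
  ... | E , lo , hi = begin
    B ℕ.* ⌊log₂ B ⌋                                                  ≤⟨ ℕ.*-mono-≤ (ℕ.<⇒≤ hi) (log-bound κ B E κ>0 hi) ⟩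
    κ ℕ.* (2 ℕ.* X ℕ.* (2 ℕ.* X)) ℕ.* ((κ ℕ.+ 2) ℕ.* suc E)          ≡⟨ e₁ κ X (suc E) ⟩
    4 ℕ.* (κ ℕ.* (κ ℕ.+ 2)) ℕ.* (suc E ℕ.* (X ℕ.* X))                ≤⟨ ℕ.*-monoʳ-≤ (4 ℕ.* (κ ℕ.* (κ ℕ.+ 2))) (many B E lo) ⟩
    4 ℕ.* (κ ℕ.* (κ ℕ.+ 2)) ℕ.* (4 ℕ.* count B)                      ≤⟨ ℕ.*-monoʳ-≤ (4 ℕ.* (κ ℕ.* (κ ℕ.+ 2))) (ℕ.*-monoʳ-≤ 4 (≤3*half (count B) 2≤count)) ⟩
    4 ℕ.* (κ ℕ.* (κ ℕ.+ 2)) ℕ.* (4 ℕ.* (3 ℕ.* (count B ℕ./ 2)))      ≡⟨ e₂ (κ ℕ.* (κ ℕ.+ 2)) (count B ℕ./ 2) ⟩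
    48 ℕ.* (κ ℕ.* (κ ℕ.+ 2)) ℕ.* (count B ℕ./ 2)                     ∎
    where
    open ℕ.≤-Reasoning
    X = 2 ℕ.^ E
    2≤count : 2 ≤ count B
    -- The threshold 4 κ makes `E = 1` available, where the hypothesis reads 8 ≤ 4 · count B.
    2≤count = ℕ.*-cancelˡ-≤ {2} {count B} 4 (many B 1 4κ≤B)
    e₁ : ∀ κ X E → κ ℕ.* (2 ℕ.* X ℕ.* (2 ℕ.* X)) ℕ.* ((κ ℕ.+ 2) ℕ.* E) ≡ 4 ℕ.* (κ ℕ.* (κ ℕ.+ 2)) ℕ.* (E ℕ.* (X ℕ.* X))
    e₁ = ℕ.solve-∀
    e₂ : ∀ c h → 4 ℕ.* c ℕ.* (4 ℕ.* (3 ℕ.* h)) ≡ 48 ℕ.* c ℕ.* h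
    e₂ = ℕ.solve-∀

  ManySolutions : ℤ → ℤ → ℤ → Set
  ManySolutions c₀ c₁ c₂ = ∃ λ κ → 0 < κ × (∀ B E → κ ℕ.* (2 ℕ.^ E ℕ.* 2 ℕ.^ E) ≤ B →
    suc E ℕ.* (2 ℕ.^ E ℕ.* 2 ℕ.^ E) ≤ 4 ℕ.* length (filter (cond? c₀ c₁ c₂) (box B)))

  base⇒many-solutions : ∀ {c₀ c₁ c₂} (base : BaseSolution c₀ c₁ c₂) → Modulus base → ManySolutions c₀ c₁ c₂
  base⇒many-solutions base mod = κ , s≤s z≤n , solutions-many
    where open Points base mod

  many-solutions⇒bound : ∀ c₀ c₁ c₂ → ManySolutions c₀ c₁ c₂ →
    Σ ℕ λ k → Σ ℕ λ B₀ → (k ℕ.> 0) × (∀ B → B₀ ≤ B → B ℕ.* ⌊log₂ B ⌋ ≤ k ℕ.* N c₀ c₁ c₂ B)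
  many-solutions⇒bound c₀ c₁ c₂ (κ , κ>0 , many) =
    48 ℕ.* (κ ℕ.* (κ ℕ.+ 2)) , κ ℕ.* 4 ,
    ℕ.*-mono-≤ {1} {48} (s≤s z≤n) (ℕ.*-mono-≤ κ>0 (ℕ.≤-trans κ>0 (ℕ.m≤m+n κ 2))) ,
    B-log-B-bound (λ B → length (filter (cond? c₀ c₁ c₂) (box B))) κ>0 many

open import Data.Nat using (_*_; _!)
open IntegerPoints

theorem1p2 : (c₀ c₁ c₂ : ℤ) → c₀ ≢ Data.Integer.0ℤ → c₁ ≢ Data.Integer.0ℤ → c₂ ≢ Data.Integer.0ℤ →
    Σ ℕ λ k → Σ ℕ λ B₀ → (k Data.Nat.> 0) × (∀ B → B₀ ≤ B → B * ⌊log₂ B ⌋ ≤ k * N c₀ c₁ c₂ B)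
theorem1p2 c₀ c₁ c₂ c₀≢0 c₁≢0 c₂≢0 =
  many-solutions⇒bound c₀ c₁ c₂ (base⇒many-solutions base (modulus base (18 !) 18!≢0 ∣18!))
  where
  base = exists-base c₀ c₁ c₂ c₀≢0 c₁≢0 c₂≢0
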